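{- Let $G=(V,E)$ be a ribbon graph with $|E|=n$, let $G_m$ be its medial graph, and let $o:E\to[n]$ be a bijection. Let $(U,\Omega)$ be the $(n,3)$-carrier in which $U$ is the set of all transitions of $G_m$ and each class of $\Omega$ consists of the three transitions at one vertex of $G_m$. Then $$\operatorname{Orb}(D_o(G))=\{D_{Z(G_m),\tau',\sigma'}\mid \tau'\in\mathbb{T}_{(U,\Omega)},\ \sigma'\in\mathbb{P}_{(U,\Omega)}\}.$$
   Context: Group action. A set system on $[n]=\{1,\dots,n\}$ is a pair $D=([n],\mathcal{F})$, $\mathcal{F}$ a collection of subsets of $[n]$. For $i\in[n]$: $D\ast i=([n],\{X\triangle\{i\}:X\in\mathcal{F}\})$ and $D+i=([n],\mathcal{F}\triangle\{I\cup\{i\}:I\in\mathcal{F},i\notin I\})$. For fixed $i$ these satisfy the relations of $\mathcal{G}=\langle\ast,+\mid\ast^2,+^2,(\ast+)^3\rangle\cong S_3$. For a word $g=g_1\cdots g_k$, $D\,g\,i:=(\cdots(D\,g_k\,i)\cdots)g_1\,i$. Operations on distinct elements commute. For $\hat g=(g_1,\dots,g_n)\in\mathcal{G}^n$, $\hat g\cdot D$ is obtained by applying $g_i$ to $i$ for all $i$. For $\pi\in S_n$, $D_\pi=([n],\{\pi(I):I\in\mathcal{F}\})$. The semidirect product $\mathcal{G}^n\rtimes_\phi S_n$, with $(\hat g,\pi_1)(\hat h,\pi_2)=(\hat g\circ\hat h\pi_1^{ -1},\pi_1\pi_2)$, $\circ$ componentwise, $(\hat h\pi^{ -1})(i)=h_{\pi^{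 -1}(i)}$, acts on set systems by $(\hat g,\pi)D=\hat g\cdot D_\pi$; $\operatorname{Orb}(D)$ is the orbit of $D$. Ribbon graphs. A ribbon graph $G=(V,E)$ is a surface with boundary that is the union of a set $V$ of discs (vertices) and a set $E$ of discs (edges) such that vertices and edges intersect in disjoint line segments, each such segment lies on the boundary of exactly one vertex and exactly one edge, and each edge contains exactly two such segments. A spanning ribbon subgraph is obtained by removing only edges. A spanning quasi-tree of a connected $G$ is a connected spanning ribbon subgraph with exactly one boundary component; for disconnected $G$, a spanning quasi-tree is a spanning ribbon subgraph $Q$ with $k(Q)=k(G)$ whose components are spanning quasi-trees of the components of $G$ ($k$ = number of connected components). The delta-matroid of $G$ is $D_o(G)=([n],\mathcal{F}(G))$ with $\mathcal{F}(G)=\{F\subseteq[n]: o^{ -1}(F)\text{ is the edge set of a spanning quasi-tree of }G\}$. Medial graph. $G_m$ is the $4$-regular graph obtained by placing a vertex $v_e$ on each edge $e$ of $G$ and drawing the edges of $G_m$ along the face boundaries (boundary components) of $G$, i.e. one edge of $G_m$ for each pair of consecutive edge-ends around a vertex of $G$, joining the corresponding vertices $v_e$, $v_f$. An isolated vertex of $G$ contributes a free loop (a circular edge without vertices, counted as a connected component). Transitions. For a $4$-regular graph $F$, a transition at a vertex $v$ is a partition of the four half-edges at $v$ into two pairs (three transitions per vertex). With $U$ the set of all transitions of $F$ and $\Omega$ the partition of $U$ by vertices, a transversal of $\Omega$ (a subset of $U$ containing exactly one element of each class; the set of these is $\mathcal{T}(\Omega)$) is a choice $T$ of transition at each vertex;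 $F|_T$ is the $2$-regular graph obtained by splitting every vertex $v$ into two vertices, each incident with one pair of half-edges of the chosen transition. Put $\mathcal{B}(F)=\{T\in\mathcal{T}(\Omega): k(F|_T)=k(F)\}$, and $Z(F)=(U,\Omega,\mathcal{B}^*(F))$, where $\mathcal{B}^*(F)=\{I: I\subseteq B\text{ for some }B\in\mathcal{B}(F)\}$; this is a tight $3$-matroid with set of bases $\mathcal{B}(F)$. From $3$-matroids to set systems. A transversal $3$-tuple is an ordered triple $(T_1,T_2,T_3)$ of mutually disjoint transversals with union $U$; $\mathbb{T}_{(U,\Omega)}$ is the set of them. A projection is a surjection $\sigma:U\to[n]$ with $\sigma(x)=\sigma(y)$ iff $x,y$ lie in the same class of $\Omega$; $\mathbb{P}_{(U,\Omega)}$ is the set of them. For a tight $3$-matroid $Z$ on $(U,\Omega)$ with set of bases $\mathcal{B}_Z$, $\tau=(T_1,T_2,T_3)$ and $\sigma$, $$D_{Z,\tau,\sigma}=([n],\{\sigma(X\cap T_2)\mid X\in\mathcal{B}_Z,\ X\subseteq T_1\cup T_2\}).$$ -}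

module Defs where

open import Level using (0ℓ)
open import Data.Bool.Base using (Bool; true; false; if_then_else_)
open import Data.Fin.Base using (Fin; zero; suc; combine; remQuot; opposite)
open import Data.Fin.Patterns using (0F; 1F; 2F; 3F)
open import Data.Fin.Permutation using (Permutation′; _⟨$⟩ʳ_)
open import Data.Fin.Properties using (remQuot-combine; combine-remQuot)
open import Data.Fin.Subset as Sub using (Subset; ⁅_⁆; _─_)
open import Data.List.Base using (List; foldr; allFin)
open import Data.Nat.Base using (ℕ)
open import Data.Nat.GeneralisedArithmetic using (iterate)
open import Data.Product using (Σ; ∃-syntax; ∃!; _×_; _,_; proj₁; proj₂)
open import Data.Refinement.Base using (Refinement; value)
open import Data.Sum.Base using (_⊎_; inj₁; inj₂)
open import Data.Vec.Base using (lookup)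
open import Function.Base using (_∘_)
open import Function.Bundles using (_⇔_; _⤖_; _↔_; module Bijection; module Inverse)
open import Function.Definitions using (Surjective)
open import Relation.Binary.Construct.Closure.Equivalence using (EqClosure)
open import Relation.Binary.Core using (Rel)
open import Relation.Binary.PropositionalEquality
  using (_≡_; _≢_; refl; sym; trans; cong)
open import Relation.Nullary.Negation using (¬_)
open import Relation.Unary using (Pred; _≐_; _∪_; _∖_)

------------------------------------------------------------------------
-- Subsets, images, and numbers of equivalence classes

-- Subsets of a finite set, as characteristic functions.  Subsets of [n]
-- are the library's `Subset n` instead, so that equal subsets are
-- propositionally equal.
FSet : Set → Set
FSet A = A → Bool

infix 4 _∈_ _⊆_

_∈_ : {A : Set} → A → FSet A → Set
x ∈ X = X x ≡ true

_⊆_ : {A : Set} → FSet A → FSet A → Set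
X ⊆ Y = ∀ {x} → x ∈ X → x ∈ Y

-- Y = f(P)
IsImage : {A : Set} {n : ℕ} → (A → Fin n) → Pred A 0ℓ → Subset n → Set
IsImage f P Y = ∀ i → i Sub.∈ Y ⇔ (∃[ x ] P x × f x ≡ i)

-- The equivalence relation generated by R has exactly k classes.
_HasClasses_ : {A : Set} → Rel A 0ℓ → ℕ → Set
_HasClasses_ {A} R k =
  Σ (A → Fin k) λ f →
    Surjective _≡_ _≡_ f × (∀ x y → EqClosure R x y ⇔ f x ≡ f y)

SameNumberOfClasses : {A B : Set} → Rel A 0ℓ → Rel B 0ℓ → Set
SameNumberOfClasses R S = ∃[ k ] R HasClasses k × S HasClasses k

------------------------------------------------------------------------
-- Set systems and the group action

-- The ground set [n] is Fin n.  Equality of set systems is _≐_.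
SetSystem : ℕ → Set₁
SetSystem n = Pred (Subset n) 0ℓ

_△_ : ∀ {n} → Subset n → Subset n → Subset n
X △ Y = (X ─ Y) Sub.∪ (Y ─ X)

_▲_ : ∀ {n} → SetSystem n → SetSystem n → SetSystem n
D ▲ D′ = (D ∖ D′) ∪ (D′ ∖ D)

data Generator : Set where
  ∗ + : Generator

applyGenerator : ∀ {n} → Generator → Fin n → SetSystem n → SetSystem n
applyGenerator ∗ i D = λ Y → ∃[ X ] D X × Y ≡ X △ ⁅ i ⁆
applyGenerator + i D =
  D ▲ (λ Y → ∃[ I ] D I × ¬ (i Sub.∈ I) × Y ≡ I Sub.∪ ⁅ i ⁆)

-- Elements of 𝒢 = ⟨ ∗ , + ∣ ∗² , +² , (∗+)³ ⟩ are given by words in the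
-- generators.  Both generators are involutions, so words without inverses
-- represent every element of 𝒢; several words may represent the same one,
-- which does not affect orbits.
Word : Set
Word = List Generator

-- The last letter of a word acts first.
applyWord : ∀ {n} → Word → Fin n → SetSystem n → SetSystem n
applyWord g i D = foldr (λ a → applyGenerator a i) D g

-- ĝ · D.  Operations at distinct elements commute, so the order in which
-- the elements of [n] are treated is immaterial.
_·_ : ∀ {n} → (Fin n → Word) → SetSystem n → SetSystem n
_·_ {n} ĝ D = foldr (λ i → applyWord (ĝ i) i) D (allFin n)

relabel : ∀ {n} → Permutation′ n → SetSystem n → SetSystem n
relabel π D = λ Y → ∃[ I ] D I × IsImage (π ⟨$⟩ʳ_) (Sub._∈ I) Y

-- The orbit of D under the semidirect product of 𝒢ⁿ and Sₙ, whose elements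
-- (ĝ , π) act by (ĝ , π) D = ĝ · D_π.
Orb : ∀ {n} → SetSystem n → Pred (SetSystem n) 0ℓ
Orb {n} D D′ =
  Σ (Fin n → Word) λ ĝ → Σ (Permutation′ n) λ π → D′ ≐ (ĝ · relabel π D)

------------------------------------------------------------------------
-- Ribbon graphs

-- A ribbon graph is recorded by how its discs are glued.  Edge e meets the
-- vertices in the two line segments (e , 0F) and (e , 1F); each segment
-- lies on exactly one vertex.  Choose an orientation of the boundary of
-- every vertex disc: `next` sends a segment to the one that follows it on
-- the boundary of its vertex.  Given these orientations, an edge disc can
-- be attached to its two segments in two ways, distinguished by `twisted`
-- (see `side` below).  A vertex without segments is an isolated disc.
record RibbonGraph : Set where
  field
    #V #E : ℕ

  Vertex : Set
  Vertex = Fin #V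

  Edge : Set
  Edge = Fin #E

  Segment : Set
  Segment = Edge × Fin 2

  field
    at      : Segment → Vertex
    next    : Segment ↔ Segment
    cyclic  : ∀ s t → at s ≡ at t ⇔ (∃[ k ] iterate (Inverse.to next) s k ≡ t)
    twisted : Edge → Bool

  -- The two endpoints of a segment: (s , 0F) is reached first and (s , 1F)
  -- last when following the chosen orientation of the vertex boundary.
  Corner : Set
  Corner = Segment × Fin 2

  -- The arc of vertex boundary leaving a corner, away from its segment,
  -- ends at the corner `arc c`.
  arc : Corner → Corner
  arc (s , 0F) = Inverse.from next s , 1F
  arc (s , 1F) = Inverse.to next s , 0F

  IsolatedVertex : Set
  IsolatedVertex = Refinement Vertex (λ v → ∀ s → at s ≢ v)

module _ (G : RibbonGraph) where
  open RibbonGraph G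

  -- A spanning ribbon subgraph (V , F) is given by its edge set F.

  -- Vertices that are joined by an edge in F.
  data Adjacent (F : FSet Edge) : Rel Vertex 0ℓ where
    edge : ∀ {e} → e ∈ F → Adjacent F (at (e , 0F)) (at (e , 1F))

  allEdges : FSet Edge
  allEdges _ = true

  -- Boundary components of (V , F) are traced through the corners of G,
  -- apart from the boundary circles of isolated vertices of G.
  BoundaryPoint : Set
  BoundaryPoint = Corner ⊎ IsolatedVertex

  -- Pairs of corners joined by an arc in the boundary of (V , F).  If e is
  -- removed then its two segments become part of the boundary.
  data BoundaryArc (F : FSet Edge) : Rel BoundaryPoint 0ℓ where
    vertexArc : ∀ c → BoundaryArc F (inj₁ c) (inj₁ (arc c))
    side      : ∀ {e} → e ∈ F → ∀ i →
                BoundaryArc F (inj₁ ((e , 0F) , i))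
                  (inj₁ ((e , 1F) , (if twisted e then i else opposite i)))
    segment   : ∀ {e} → ¬ (e ∈ F) → ∀ j →
                BoundaryArc F (inj₁ ((e , j) , 0F)) (inj₁ ((e , j) , 1F))

  vertexOf : BoundaryPoint → Vertex
  vertexOf (inj₁ (s , _)) = at s
  vertexOf (inj₂ v)       = value v

  -- The component of (V , F) containing v is connected, spans the component
  -- of G containing v, and has exactly one boundary component.
  QuasiTreeAt : FSet Edge → Vertex → Set
  QuasiTreeAt F v =
    (∀ w → EqClosure (Adjacent allEdges) v w → EqClosure (Adjacent F) v w)
    × (∃[ p ] EqClosure (Adjacent F) v (vertexOf p))
    × (∀ p q → EqClosure (Adjacent F) v (vertexOf p) →
               EqClosure (Adjacent F) v (vertexOf q) →
               EqClosure (BoundaryArc F) p q)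

  IsSpanningQuasiTree : FSet Edge → Set
  IsSpanningQuasiTree F =
    SameNumberOfClasses (Adjacent F) (Adjacent allEdges)
    × (∀ v → QuasiTreeAt F v)

  deltaMatroid : ∀ {n} → Edge ⤖ Fin n → SetSystem n
  deltaMatroid o F = IsSpanningQuasiTree (λ e → lookup F (Bijection.to o e))

------------------------------------------------------------------------
-- Graphs, 4-regular graphs, medial graphs and transitions

-- Loops, multiple edges and free loops are allowed; an edge is a pair of
-- half-edges exchanged by `mate`.
record Graph : Set₁ where
  field
    Vertex HalfEdge FreeLoop : Set
    at   : HalfEdge → Vertex
    mate : HalfEdge → HalfEdge

-- Every free loop is a connected component of its own.
data Linked (F : Graph) : Rel (Graph.Vertex F ⊎ Graph.FreeLoop F) 0ℓ where
  link : ∀ h → Linked F (inj₁ (Graph.at F h))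
                        (inj₁ (Graph.at F (Graph.mate F h)))

-- The half-edges at the vertex v are (v , 0F), …, (v , 3F).
record FourRegularGraph : Set₁ where
  field
    order : ℕ

  Vertex : Set
  Vertex = Fin order

  HalfEdge : Set
  HalfEdge = Vertex × Fin 4

  field
    mate             : HalfEdge → HalfEdge
    mate-involutive  : ∀ h → mate (mate h) ≡ h
    mate-irreflexive : ∀ h → mate h ≢ h
    FreeLoop         : Set

  graph : Graph
  graph = record
    { Vertex = Vertex ; HalfEdge = HalfEdge ; FreeLoop = FreeLoop
    ; at = proj₁ ; mate = mate }

-- The vertex of the medial graph placed on e has one half-edge for each
-- corner of e, and its edges are the arcs of vertex boundary between
-- consecutive segments.
module _ (G : RibbonGraph) where
  open RibbonGraph G

  fromCorner : Corner → Edge × Fin 4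
  fromCorner ((e , j) , i) = e , combine j i

  toCorner : Edge × Fin 4 → Corner
  toCorner (e , h) = (e , proj₁ (remQuot {2} 2 h)) , proj₂ (remQuot {2} 2 h)

  to∘from : ∀ c → toCorner (fromCorner c) ≡ c
  to∘from ((e , j) , i) =
    cong (λ p → (e , proj₁ p) , proj₂ p) (remQuot-combine {2} {2} j i)

  from∘to : ∀ h → fromCorner (toCorner h) ≡ h
  from∘to (e , h) = cong (e ,_) (combine-remQuot {2} 2 h)

  arc-involutive : ∀ c → arc (arc c) ≡ c
  arc-involutive (s , 0F) = cong (_, 0F) (Inverse.strictlyInverseˡ next s)
  arc-involutive (s , 1F) = cong (_, 1F) (Inverse.strictlyInverseʳ next s)

  arc-irreflexive : ∀ c → arc c ≢ c
  arc-irreflexive (s , 0F) eq with cong proj₂ eq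
  ... | ()
  arc-irreflexive (s , 1F) eq with cong proj₂ eq
  ... | ()

  medial : FourRegularGraph
  medial = record
    { order            = #E
    ; mate             = λ h → fromCorner (arc (toCorner h))
    ; mate-involutive  = λ h →
        trans (cong (fromCorner ∘ arc) (to∘from (arc (toCorner h))))
          (trans (cong fromCorner (arc-involutive (toCorner h))) (from∘to h))
    ; mate-irreflexive = λ h eq →
        arc-irreflexive (toCorner h)
          (trans (sym (to∘from (arc (toCorner h)))) (cong toCorner eq))
    ; FreeLoop         = IsolatedVertex
    }

-- The three partitions of four half-edges into two pairs.
data Pairing : Set where
  01∣23 02∣13 03∣12 : Pairing

-- The part of the partition to which a half-edge belongs.
part : Pairing → Fin 4 → Fin 2
part 01∣23 0F = 0F
part 01∣23 1F = 0F
part 01∣23 2F = 1F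
part 01∣23 3F = 1F
part 02∣13 0F = 0F
part 02∣13 1F = 1F
part 02∣13 2F = 0F
part 02∣13 3F = 1F
part 03∣12 0F = 0F
part 03∣12 1F = 1F
part 03∣12 2F = 1F
part 03∣12 3F = 0F

-- Splitting every vertex v into two vertices, one for each part of the
-- transition chosen at v.
split : (F : FourRegularGraph) → (FourRegularGraph.Vertex F → Pairing) → Graph
split F T = record
  { Vertex   = Vertex × Fin 2
  ; HalfEdge = HalfEdge
  ; FreeLoop = FreeLoop
  ; at       = λ h → proj₁ h , part (T (proj₁ h)) (proj₂ h)
  ; mate     = mate
  }
  where open FourRegularGraph F

------------------------------------------------------------------------
-- Carriers and 3-matroids

-- Ω is the relation of lying in the same class.
record Carrier : Set₁ where
  field
    U : Set
    Ω : Rel U 0ℓ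

module _ (C : Carrier) where
  open Carrier C

  IsTransversal : FSet U → Set
  IsTransversal T = ∀ u → ∃! _≡_ λ v → Ω v u × v ∈ T

  record TransversalTriple : Set where
    field
      T₁ T₂ T₃     : FSet U
      transversal₁ : IsTransversal T₁
      transversal₂ : IsTransversal T₂
      transversal₃ : IsTransversal T₃
      disjoint₁₂   : ∀ u → ¬ (u ∈ T₁ × u ∈ T₂)
      disjoint₁₃   : ∀ u → ¬ (u ∈ T₁ × u ∈ T₃)
      disjoint₂₃   : ∀ u → ¬ (u ∈ T₂ × u ∈ T₃)
      covering     : ∀ u → u ∈ T₁ ⊎ u ∈ T₂ ⊎ u ∈ T₃

  record Projection (n : ℕ) : Set where
    field
      σ          : U → Fin n
      surjective : Surjective _≡_ _≡_ σ
      classes    : ∀ x y → σ x ≡ σ y ⇔ Ω x y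

-- The data (U , Ω , independent sets) of a 3-matroid.  Its axioms play no
-- part in the construction of set systems and are not recorded.
record MultimatroidData : Set₁ where
  field
    carrier     : Carrier
    Independent : FSet (Carrier.U carrier) → Set

  IsBasis : FSet (Carrier.U carrier) → Set
  IsBasis B = Independent B × (∀ J → Independent J → B ⊆ J → J ⊆ B)

module _ (Z : MultimatroidData) where
  open MultimatroidData Z
  open TransversalTriple
  open Projection

  setSystem : ∀ {n} → TransversalTriple carrier → Projection carrier n → SetSystem n
  setSystem τ σ′ Y =
    ∃[ X ] IsBasis X
      × (∀ u → u ∈ X → u ∈ T₁ τ ⊎ u ∈ T₂ τ)
      × IsImage (σ σ′) (λ u → u ∈ X × u ∈ T₂ τ) Y

module _ (F : FourRegularGraph) where
  open FourRegularGraph F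

  transitions : Carrier
  transitions = record
    { U = Vertex × Pairing
    ; Ω = λ x y → proj₁ x ≡ proj₁ y
    }

  -- 𝓑(F).  The function t is the choice of transitions encoded by the
  -- transversal T, which determines it.
  𝓑 : FSet (Vertex × Pairing) → Set
  𝓑 T = IsTransversal transitions T
    × (Σ (Vertex → Pairing) λ t → (∀ v → (v , t v) ∈ T)
       × SameNumberOfClasses (Linked (split F t)) (Linked graph))

  Z : MultimatroidData
  Z = record
    { carrier     = transitions
    ; Independent = λ I → ∃[ B ] 𝓑 B × I ⊆ B
    }

-- { D_{Z(F),τ,σ} ∣ τ a transversal triple, σ a projection }
SetSystemsOf : ∀ n → FourRegularGraph → Pred (SetSystem n) 0ℓ
SetSystemsOf n F D =
  Σ (TransversalTriple (transitions F)) λ τ →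
  Σ (Projection (transitions F) n) λ σ → D ≐ setSystem (Z F) τ σ

{-# OPTIONS --safe #-}
module Submission where

-- Both sides consist of the set systems obtained from a numbering of the
-- vertices of the medial graph and an ordering of the three transitions at
-- each vertex: Y is feasible when the first transition outside Y and the
-- second inside Y together keep all half-edges at each vertex connected.
-- The boundary components of a spanning ribbon subgraph are the trails of
-- such a choice, so D_o(G) has this form.  ∗ exchanges the first two
-- transitions and + the last two; for + this is tightness: the trails that
-- leave a vertex return to it in two pairs, the transition matching these
-- pairs disconnects, and the other two connect equally well.  Both
-- exchanges generate all orderings, so the orbit is everything.

open import Defs
open import Level using (0ℓ)
open import Data.Bool.Base using (Bool; true; false; not; if_then_else_; _xor_; _∨_)
open import Data.Bool.Properties using (⇔→≡; xor-identityʳ; ¬-not; ∨-zeroʳ; ∨-identityʳ)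
open import Data.Empty using (⊥-elim-irr)
open import Data.Fin.Base using (Fin; zero; suc; opposite; punchIn; punchOut)
open import Data.Fin.Patterns using (0F; 1F; 2F; 3F)
open import Data.Fin.Permutation using (Permutation′; _∘ₚ_; _⟨$⟩ʳ_; _⟨$⟩ˡ_; flip)
open import Data.Fin.Properties
  using (_≟_; all?; any?; injective⇒≤; punchOut-injective; punchOut-punchIn; punchOut-cong;
         punchInᵢ≢i)
open import Data.Fin.Subset as Sub using (Subset; ⁅_⁆)
open import Data.Fin.Subset.Properties using (x∈⁅x⁆; x≢y⇒x∉⁅y⁆)
open import Data.Irrelevant using ([_])
open import Data.List.Base using (List; []; _∷_; _++_; map; foldr; filter; allFin)
open import Data.List.Membership.Propositional using () renaming (_∈_ to _∈ˡ_; _∉_ to _∉ˡ_)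
open import Data.List.Membership.Propositional.Properties
  using (∈-allFin; ∈-map⁺; ∈-map⁻; ∈-filter⁺; ∈-filter⁻)
open import Data.List.Properties using (foldr-++)
open import Data.List.Relation.Unary.All as All using ()
open import Data.List.Relation.Unary.AllPairs using ([]; _∷_)
open import Data.List.Relation.Unary.Any using (here; there)
open import Data.List.Relation.Unary.Unique.Propositional using (Unique)
open import Data.List.Relation.Unary.Unique.Propositional.Properties as Uniqueₚ using ()
open import Data.Nat.Base using (ℕ; zero; suc)
open import Data.Nat.GeneralisedArithmetic using (iterate)
open import Data.Nat.Properties using (1+n≰n)
open import Data.Product as Product using (Σ; ∃; ∃-syntax; _×_; _,_; proj₁; proj₂)
open import Data.Product.Properties using (≡-dec)
open import Data.Refinement.Base using (_,_)
open import Data.Sum.Base as Sum using (_⊎_; inj₁; inj₂)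
open import Data.Sum.Properties using (inj₁-injective)
open import Data.Sum.Relation.Binary.Pointwise as Pointwise using (drop-inj₁; ⊎-isEquivalence)
open import Data.Unit.Base using (⊤)
open import Data.Vec.Base using ([]; _∷_; lookup; tabulate)
open import Data.Vec.Properties using (lookup∘tabulate; []=⇒lookup; lookup⇒[]=; lookup-zipWith)
open import Data.Vec.Relation.Binary.Pointwise.Extensional using (ext; Pointwise-≡⇒≡)
open import Function.Base using (_∘_; id)
open import Function.Bundles
  using (_⇔_; mk⇔; _↔_; _⤖_; mk↔ₛ′; module Equivalence; module Inverse; module Injection)
open import Function.Definitions using (Injective; Surjective)
open import Function.Properties.Bijection using (⤖⇒↔)
open import Function.Properties.Inverse using (↔⇒↣)
open import Relation.Binary.Construct.Closure.Equivalence as EqC using (EqClosure)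
open import Relation.Binary.Construct.Closure.ReflexiveTransitive using (ε; _◅_)
open import Relation.Binary.Construct.Closure.Symmetric using (fwd; bwd)
import Relation.Binary.Construct.On as On
open import Relation.Binary.Core using (Rel; _⇒_)
open import Relation.Binary.Definitions using (DecidableEquality)
open import Relation.Binary.PropositionalEquality
  using (_≡_; _≢_; _≗_; refl; sym; trans; cong; cong₂; subst; subst₂; ≢-sym; isEquivalence)
open import Relation.Binary.Structures using (IsEquivalence)
open import Relation.Nullary using (¬_; Dec; yes; no; does; contradiction; ¬?)
open import Relation.Nullary.Decidable using (decidable-stable; from-yes; _→-dec_; _⊎-dec_)
open import Relation.Unary using (Pred; _≐_)
open import Relation.Unary.Properties using (≐-refl; ≐-sym; ≐-trans)


open Equivalence using (to; from)

-- Component counts are replaced by the local condition `Connecting`. Forgetting the splitting maps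
-- the components of F|_T onto those of F, so the two numbers agree exactly when this map is
-- injective, that is, when the half-edges at each vertex stay connected. Counts then enter only
-- where `SameNumberOfClasses` asks for them, and there an explicit numbering of the components has
-- to be built. The symmetric difference in + contains negations, so it seems to ask which
-- transversals connect. Connectivity is never decided: `return-pairing` computes one pairing at the
-- vertex, and locating it among the three transitions settles every case.

-- Joins of equivalence relations and numberings of their classes

module _ {A : Set} where

  -- For an equivalence `_~_`, a closed form of the equivalence generated by `_~_` and the pair (a ,
  -- b): a path that uses the new pair twice can be shortened, so at most one use is needed. Unlike
  -- `EqClosure`, it can be analysed in three cases.
  Join : Rel A 0ℓ → A → A → Rel A 0ℓ
  Join _~_ a b x y = x ~ y ⊎ (x ~ a × b ~ y) ⊎ (x ~ b × a ~ y)

  module _ {_~_ : Rel A 0ℓ} (~-equiv : IsEquivalence _~_) {a b : A} where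
    private module ~ = IsEquivalence ~-equiv

    join-isEquivalence : IsEquivalence (Join _~_ a b)
    join-isEquivalence = record
      { refl  = inj₁ ~.refl
      ; sym   = λ where
          (inj₁ p)              → inj₁ (~.sym p)
          (inj₂ (inj₁ (p , q))) → inj₂ (inj₂ (~.sym q , ~.sym p))
          (inj₂ (inj₂ (p , q))) → inj₂ (inj₁ (~.sym q , ~.sym p))
      ; trans = λ where
          (inj₁ p) (inj₁ q)                           → inj₁ (~.trans p q)
          (inj₁ p) (inj₂ (inj₁ (q , r)))              → inj₂ (inj₁ (~.trans p q , r))
          (inj₁ p) (inj₂ (inj₂ (q , r)))              → inj₂ (inj₂ (~.trans p q , r))
          (inj₂ (inj₁ (p , q))) (inj₁ r)              → inj₂ (inj₁ (p , ~.trans q r))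
          (inj₂ (inj₂ (p , q))) (inj₁ r)              → inj₂ (inj₂ (p , ~.trans q r))
          (inj₂ (inj₁ (p , _))) (inj₂ (inj₁ (_ , q))) → inj₂ (inj₁ (p , q))
          (inj₂ (inj₁ (p , _))) (inj₂ (inj₂ (_ , q))) → inj₁ (~.trans p q)
          (inj₂ (inj₂ (p , _))) (inj₂ (inj₁ (_ , q))) → inj₁ (~.trans p q)
          (inj₂ (inj₂ (p , _))) (inj₂ (inj₂ (_ , q))) → inj₂ (inj₂ (p , q))
      }

    join-pair : Join _~_ a b a b
    join-pair = inj₂ (inj₁ (~.refl , ~.refl))

  join-least : {_~_ _≈_ : Rel A 0ℓ} → IsEquivalence _≈_ → _~_ ⇒ _≈_ →
               ∀ {a b} → a ≈ b → Join _~_ a b ⇒ _≈_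
  join-least ≈-equiv ~⇒≈ a≈b = λ where
      (inj₁ p)              → ~⇒≈ p
      (inj₂ (inj₁ (p , q))) → ≈.trans (~⇒≈ p) (≈.trans a≈b (~⇒≈ q))
      (inj₂ (inj₂ (p , q))) → ≈.trans (~⇒≈ p) (≈.trans (≈.sym a≈b) (~⇒≈ q))
    where module ≈ = IsEquivalence ≈-equiv

  joinAll : List (A × A) → Rel A 0ℓ
  joinAll []             = _≡_
  joinAll ((a , b) ∷ ps) = Join (joinAll ps) a b

  joinAll-isEquivalence : ∀ ps → IsEquivalence (joinAll ps)
  joinAll-isEquivalence []       = isEquivalence
  joinAll-isEquivalence (_ ∷ ps) = join-isEquivalence (joinAll-isEquivalence ps)

  joinAll-member : ∀ ps {a b} → (a , b) ∈ˡ ps → joinAll ps a b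
  joinAll-member (_ ∷ ps) (here refl) = join-pair (joinAll-isEquivalence ps)
  joinAll-member (_ ∷ ps) (there p)   = inj₁ (joinAll-member ps p)

  joinAll-least : {_≈_ : Rel A 0ℓ} → IsEquivalence _≈_ → ∀ ps →
                  (∀ {a b} → (a , b) ∈ˡ ps → a ≈ b) → joinAll ps ⇒ _≈_
  joinAll-least ≈-equiv []       _ refl = IsEquivalence.refl ≈-equiv
  joinAll-least ≈-equiv (_ ∷ ps) h      =
    join-least ≈-equiv (joinAll-least ≈-equiv ps (h ∘ there)) (h (here refl))

  -- `R HasClasses k` is `Numbering (EqClosure R) k`. Leaving out the closure lets a numbering be
  -- carried along a sequence of joins.
  Numbering : Rel A 0ℓ → ℕ → Set
  Numbering _~_ k =
    Σ (A → Fin k) λ f → Surjective _≡_ _≡_ f × (∀ x y → x ~ y ⇔ f x ≡ f y)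

  numbering-resp-⇔ : {_~_ _≈_ : Rel A 0ℓ} → _~_ ⇒ _≈_ → _≈_ ⇒ _~_ →
                     ∀ {k} → Numbering _~_ k → Numbering _≈_ k
  numbering-resp-⇔ ~⇒≈ ≈⇒~ (f , f-surj , f-classes) =
    f , f-surj , λ x y →
      mk⇔ (to (f-classes x y) ∘ ≈⇒~) (~⇒≈ ∘ from (f-classes x y))

module _ {k : ℕ} (i j : Fin (suc k)) (j≢i : j ≢ i) where

  fuse : Fin (suc k) → Fin k
  fuse l with j ≟ l
  ... | yes _  = punchOut j≢i
  ... | no j≢l = punchOut j≢l

  fuse-surjective : ∀ l → fuse (punchIn j l) ≡ l
  fuse-surjective l with j ≟ punchIn j l
  ... | yes eq = contradiction (sym eq) (punchInᵢ≢i j l)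
  ... | no _   = trans (punchOut-cong j refl) (punchOut-punchIn j)

  fuse-injective : ∀ x y → fuse x ≡ fuse y → Join _≡_ i j x y
  fuse-injective x y eq with j ≟ x | j ≟ y
  ... | yes refl | yes refl = inj₁ refl
  ... | yes refl | no j≢y   = inj₂ (inj₂ (refl , punchOut-injective j≢i j≢y eq))
  ... | no j≢x   | yes refl = inj₂ (inj₁ (punchOut-injective j≢x j≢i eq , refl))
  ... | no j≢x   | no j≢y   = inj₁ (punchOut-injective j≢x j≢y eq)

  fuse-fuses : fuse i ≡ fuse j
  fuse-fuses with j ≟ i | j ≟ j
  ... | yes j≡i | _      = contradiction j≡i j≢i
  ... | no _    | yes _  = punchOut-cong j refl
  ... | no _    | no j≢j = contradiction refl j≢j

module _ {A : Set} where

  -- Comparing the labels of a and b tells whether they are already related. If so, the numbering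
  -- stays valid; if not, their labels are fused and one class disappears.
  join-numbering : {_~_ : Rel A 0ℓ} → ∀ {k} → Numbering _~_ k →
                   ∀ a b → ∃ (Numbering (Join _~_ a b))
  join-numbering {k = zero} (f , _) a b with () ← f a
  join-numbering {_~_} {suc k} (f , f-surj , f-classes) a b with f b ≟ f a
  ... | yes eq = suc k , f , f-surj , λ x y → mk⇔
        (λ where
          (inj₁ p)              → to (f-classes _ _) p
          (inj₂ (inj₁ (p , q))) → trans (to (f-classes _ _) p) (trans (sym eq) (to (f-classes _ _) q))
          (inj₂ (inj₂ (p , q))) → trans (to (f-classes _ _) p) (trans eq (to (f-classes _ _) q)))
        (inj₁ ∘ from (f-classes x y))
  ... | no neq = k , g ∘ f
        , (λ l → proj₁ (f-surj (punchIn (f b) l))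
               , λ { refl → trans (cong g (proj₂ (f-surj _) refl))
                                (fuse-surjective (f a) (f b) neq l) })
        , λ x y → mk⇔
        (λ where
          (inj₁ p)              → cong g (to (f-classes _ _) p)
          (inj₂ (inj₁ (p , q))) → trans (cong g (to (f-classes _ _) p))
            (trans fused (cong g (to (f-classes _ _) q)))
          (inj₂ (inj₂ (p , q))) → trans (cong g (to (f-classes _ _) p))
            (trans (sym fused) (cong g (to (f-classes _ _) q))))
        (back x y ∘ fuse-injective (f a) (f b) neq (f x) (f y))
    where
    g : Fin (suc k) → Fin k
    g = fuse (f a) (f b) neq

    fused : g (f a) ≡ g (f b)
    fused = fuse-fuses (f a) (f b) neq

    back : ∀ x y → Join _≡_ (f a) (f b) (f x) (f y) → Join _~_ a b x y
    back x y (inj₁ p)              = inj₁ (from (f-classes _ _) p)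
    back x y (inj₂ (inj₁ (p , q))) = inj₂ (inj₁ (from (f-classes _ _) p , from (f-classes _ _) q))
    back x y (inj₂ (inj₂ (p , q))) = inj₂ (inj₂ (from (f-classes _ _) p , from (f-classes _ _) q))

joinAll-numbering : ∀ {n} (ps : List (Fin n × Fin n)) → ∃ (Numbering (joinAll ps))
joinAll-numbering []             =
  _ , id , (λ i → i , id) , λ _ _ → mk⇔ id id
joinAll-numbering ((a , b) ∷ ps) = join-numbering (proj₂ (joinAll-numbering ps)) a b

-- Turns equal numbers of classes into injectivity of an induced map between classes.
surjective⇒injective : ∀ {k} {f : Fin k → Fin k} →
                       Surjective _≡_ _≡_ f → Injective _≡_ _≡_ f
surjective⇒injective {zero}  _ {()}
surjective⇒injective {suc k} {f} f-surj {x} {y} fx≡fy =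
  trans (sym (g∘f x)) (trans (cong g fx≡fy) (g∘f y))
  where
  g : Fin (suc k) → Fin (suc k)
  g = proj₁ ∘ f-surj

  f∘g : ∀ i → f (g i) ≡ i
  f∘g i = proj₂ (f-surj i) refl

  g-injective : Injective _≡_ _≡_ g
  g-injective {i} {j} eq = trans (sym (f∘g i)) (trans (cong f eq) (f∘g j))

  -- A z missed by g would make g an injection into k elements.
  g∘f : ∀ z → g (f z) ≡ z
  g∘f z = decidable-stable (g (f z) ≟ z) λ missed →
    let z≢g : ∀ i → z ≢ g i
        z≢g i eq = missed (trans (cong g (trans (cong f eq) (f∘g i))) (sym eq))
    in 1+n≰n (injective⇒≤ {f = λ i → punchOut (z≢g i)} λ {i} {j} eq →
         g-injective (punchOut-injective (z≢g i) (z≢g j) eq))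

-- Ends of paths

-- X is to be thought of as the set of ends of the path components of a
-- graph with connectivity relation _~_.
Paired : {A : Set} → Rel A 0ℓ → Pred A 0ℓ → Set
Paired _~_ X = ∀ {x} → X x → ∃[ y ] X y × y ≢ x × x ~ y
                 × (∀ {z} → X z → x ~ z → z ≡ x ⊎ z ≡ y)

unlinked : {A : Set} {_~_ : Rel A 0ℓ} {X : Pred A 0ℓ} {x y z : A} →
           (∀ {z} → X z → x ~ z → z ≡ x ⊎ z ≡ y) → X z → z ≢ x → z ≢ y → ¬ (x ~ z)
unlinked only z∈X z≢x z≢y x~z with only z∈X x~z
... | inj₁ z≡x = z≢x z≡x
... | inj₂ z≡y = z≢y z≡y

module _ {A : Set} (_≟ᴬ_ : DecidableEquality A) where

  -- An edge between two ends a and b either closes a path into a cycle or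
  -- concatenates two paths.
  paired-join : {_~_ : Rel A 0ℓ} {X : Pred A 0ℓ} → IsEquivalence _~_ → Paired _~_ X →
                ∀ {a b} → X a → X b → a ≢ b →
                Paired (Join _~_ a b) (λ x → X x × x ≢ a × x ≢ b)
  paired-join {_~_} {X} ~-equiv paired {a} {b} a∈X b∈X a≢b {x} (x∈X , x≢a , x≢b)
    with paired a∈X | paired b∈X | paired x∈X
  ... | a′ , a′∈X , a′≢a , a~a′ , only-a | b′ , b′∈X , b′≢b , b~b′ , only-b
      | y , y∈X , y≢x , x~y , only-x
    -- Here a′, b′ and y are the other ends of the paths from a, b and x. If b is a′, a cycle closes
    -- and every other path keeps its ends. Otherwise a′ and b′ become the two ends of one path, and
    -- x matters only if it is one of them.
    with b ≟ᴬ a′ | x ≟ᴬ a′ | x ≟ᴬ b′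
  ... | yes refl | _ | _ =
    y , (y∈X , (λ { refl → alone (only-a x∈X (~.sym x~y)) })
             , (λ { refl → alone (only-a x∈X (~.trans a~a′ (~.sym x~y))) }))
      , y≢x , inj₁ x~y
      , λ (z∈X , _) p → only-x z∈X (join-least ~-equiv id a~a′ p)
    where
    module ~ = IsEquivalence ~-equiv
    alone : ¬ (x ≡ a ⊎ x ≡ b)
    alone (inj₁ x≡a) = x≢a x≡a
    alone (inj₂ x≡b) = x≢b x≡b
  ... | no b≢a′ | yes refl | _ =
    b′ , (b′∈X , (λ { refl → a≁b (~.sym b~b′) }) , b′≢b) , (λ { refl → a≁b (~.trans a~a′ (~.sym b~b′)) })
       , inj₂ (inj₁ (~.sym a~a′ , b~b′))
       , only
    where
    module ~ = IsEquivalence ~-equiv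
    a≁b : ¬ (a ~ b)
    a≁b = unlinked {_~_ = _~_} only-a b∈X (≢-sym a≢b) b≢a′
    only : ∀ {z} → X z × z ≢ a × z ≢ b → Join _~_ a b x z → z ≡ x ⊎ z ≡ b′
    only (z∈X , z≢a , z≢b) (inj₁ x~z) with only-a z∈X (~.trans a~a′ x~z)
    ... | inj₁ z≡a = contradiction z≡a z≢a
    ... | inj₂ z≡x = inj₁ z≡x
    only (z∈X , z≢a , z≢b) (inj₂ (inj₁ (_ , b~z))) with only-b z∈X b~z
    ... | inj₁ z≡b = contradiction z≡b z≢b
    ... | inj₂ z≡b′ = inj₂ z≡b′
    only _ (inj₂ (inj₂ (x~b , _))) = contradiction (~.trans a~a′ x~b) a≁b
  ... | no b≢a′ | no x≢a′ | yes refl =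
    a′ , (a′∈X , a′≢a , (λ { refl → a≁b a~a′ })) , (λ { refl → a≁b (~.trans a~a′ (~.sym b~b′)) })
       , inj₂ (inj₂ (~.sym b~b′ , a~a′))
       , only
    where
    module ~ = IsEquivalence ~-equiv
    a≁b : ¬ (a ~ b)
    a≁b = unlinked {_~_ = _~_} only-a b∈X (≢-sym a≢b) b≢a′
    only : ∀ {z} → X z × z ≢ a × z ≢ b → Join _~_ a b x z → z ≡ x ⊎ z ≡ a′
    only (z∈X , z≢a , z≢b) (inj₁ x~z) with only-b z∈X (~.trans b~b′ x~z)
    ... | inj₁ z≡b = contradiction z≡b z≢b
    ... | inj₂ z≡x = inj₁ z≡x
    only _ (inj₂ (inj₁ (x~a , _))) = contradiction (~.sym (~.trans b~b′ x~a)) a≁b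
    only (z∈X , z≢a , z≢b) (inj₂ (inj₂ (_ , a~z))) with only-a z∈X a~z
    ... | inj₁ z≡a = contradiction z≡a z≢a
    ... | inj₂ z≡a′ = inj₂ z≡a′
  ... | no b≢a′ | no x≢a′ | no x≢b′ =
    y , (y∈X , (λ { refl → x≁a x~y }) , (λ { refl → x≁b x~y })) , y≢x , inj₁ x~y
      , λ where
          (z∈X , _) (inj₁ x~z)      → only-x z∈X x~z
          _ (inj₂ (inj₁ (x~a , _))) → contradiction x~a x≁a
          _ (inj₂ (inj₂ (x~b , _))) → contradiction x~b x≁b
    where
    module ~ = IsEquivalence ~-equiv
    x≁a : ¬ (x ~ a)
    x≁a = unlinked {_~_ = _~_} only-a x∈X x≢a x≢a′ ∘ ~.sym
    x≁b : ¬ (x ~ b)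
    x≁b = unlinked {_~_ = _~_} only-b x∈X x≢b x≢b′ ∘ ~.sym

-- Pairings of four half-edges, and frames

partner : Pairing → Fin 4 → Fin 4
partner 01∣23 0F = 1F
partner 01∣23 1F = 0F
partner 01∣23 2F = 3F
partner 01∣23 3F = 2F
partner 02∣13 0F = 2F
partner 02∣13 1F = 3F
partner 02∣13 2F = 0F
partner 02∣13 3F = 1F
partner 03∣12 0F = 3F
partner 03∣12 1F = 2F
partner 03∣12 2F = 1F
partner 03∣12 3F = 0F

-- A representative of the pair that avoids 0F. Linking 0F and this half-edge to their partners
-- generates the whole pairing, so passing a vertex costs two joins.
outside₀ : Pairing → Fin 4
outside₀ 01∣23 = 2F
outside₀ 02∣13 = 1F
outside₀ 03∣12 = 1F

module _ {_≈_ : Rel (Fin 4) 0ℓ} (≈-equiv : IsEquivalence _≈_) where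
  private module ≈ = IsEquivalence ≈-equiv

  partner-generated : ∀ p → 0F ≈ partner p 0F → outside₀ p ≈ partner p (outside₀ p) →
                      ∀ i → i ≈ partner p i
  partner-generated 01∣23 x y = λ { 0F → x ; 1F → ≈.sym x ; 2F → y ; 3F → ≈.sym y }
  partner-generated 02∣13 x y = λ { 0F → x ; 1F → y ; 2F → ≈.sym x ; 3F → ≈.sym y }
  partner-generated 03∣12 x y = λ { 0F → x ; 1F → y ; 2F → ≈.sym y ; 3F → ≈.sym x }

  private
    to-0F : ∀ p q → p ≢ q → (∀ i → i ≈ partner p i) → (∀ i → i ≈ partner q i) → ∀ i → i ≈ 0F
    to-0F _     _     _   P Q 0F = ≈.refl
    to-0F 01∣23 01∣23 p≢q P Q i  = contradiction refl p≢q
    to-0F 01∣23 02∣13 _   P Q 1F = P 1F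
    to-0F 01∣23 02∣13 _   P Q 2F = Q 2F
    to-0F 01∣23 02∣13 _   P Q 3F = ≈.trans (P 3F) (Q 2F)
    to-0F 01∣23 03∣12 _   P Q 1F = P 1F
    to-0F 01∣23 03∣12 _   P Q 2F = ≈.trans (P 2F) (Q 3F)
    to-0F 01∣23 03∣12 _   P Q 3F = Q 3F
    to-0F 02∣13 01∣23 _   P Q 1F = Q 1F
    to-0F 02∣13 01∣23 _   P Q 2F = P 2F
    to-0F 02∣13 01∣23 _   P Q 3F = ≈.trans (P 3F) (Q 1F)
    to-0F 02∣13 02∣13 p≢q P Q i  = contradiction refl p≢q
    to-0F 02∣13 03∣12 _   P Q 1F = ≈.trans (P 1F) (Q 3F)
    to-0F 02∣13 03∣12 _   P Q 2F = P 2F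
    to-0F 02∣13 03∣12 _   P Q 3F = Q 3F
    to-0F 03∣12 01∣23 _   P Q 1F = Q 1F
    to-0F 03∣12 01∣23 _   P Q 2F = ≈.trans (P 2F) (Q 1F)
    to-0F 03∣12 01∣23 _   P Q 3F = P 3F
    to-0F 03∣12 02∣13 _   P Q 1F = ≈.trans (P 1F) (Q 2F)
    to-0F 03∣12 02∣13 _   P Q 2F = Q 2F
    to-0F 03∣12 02∣13 _   P Q 3F = P 3F
    to-0F 03∣12 03∣12 p≢q P Q i  = contradiction refl p≢q

  -- Two different perfect matchings of four points form a 4-cycle.
  two-pairings-connect : ∀ {p q} → p ≢ q → (∀ i → i ≈ partner p i) →
                         (∀ i → i ≈ partner q i) → ∀ i j → i ≈ j
  two-pairings-connect p≢q P Q i j =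
    ≈.trans (to-0F _ _ p≢q P Q i) (≈.sym (to-0F _ _ p≢q P Q j))

part-partner : ∀ p i → part p (partner p i) ≡ part p i
part-partner 01∣23 = λ { 0F → refl ; 1F → refl ; 2F → refl ; 3F → refl }
part-partner 02∣13 = λ { 0F → refl ; 1F → refl ; 2F → refl ; 3F → refl }
part-partner 03∣12 = λ { 0F → refl ; 1F → refl ; 2F → refl ; 3F → refl }

pairing-of : ∀ j → j ≢ 0F → ∃[ p ] partner p 0F ≡ j
pairing-of 0F j≢0 = contradiction refl j≢0
pairing-of 1F _   = 01∣23 , refl
pairing-of 2F _   = 02∣13 , refl
pairing-of 3F _   = 03∣12 , refl

outside₀-≢ : ∀ p → outside₀ p ≢ 0F × outside₀ p ≢ partner p 0F
                 × outside₀ p ≢ partner p (outside₀ p)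
outside₀-≢ 01∣23 = (λ ()) , (λ ()) , (λ ())
outside₀-≢ 02∣13 = (λ ()) , (λ ()) , (λ ())
outside₀-≢ 03∣12 = (λ ()) , (λ ()) , (λ ())

partner-≢ : ∀ p → 0F ≢ partner p 0F × partner p (outside₀ p) ≢ 0F × partner p (outside₀ p) ≢ partner p 0F
partner-≢ 01∣23 = (λ ()) , (λ ()) , (λ ())
partner-≢ 02∣13 = (λ ()) , (λ ()) , (λ ())
partner-≢ 03∣12 = (λ ()) , (λ ()) , (λ ())

remaining : ∀ p j → j ≢ 0F → j ≢ partner p 0F → j ≢ outside₀ p → j ≡ partner p (outside₀ p)
remaining p     0F a b c = contradiction refl a
remaining 01∣23 1F a b c = contradiction refl b
remaining 01∣23 2F a b c = contradiction refl c
remaining 01∣23 3F a b c = refl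
remaining 02∣13 1F a b c = contradiction refl c
remaining 02∣13 2F a b c = contradiction refl b
remaining 02∣13 3F a b c = refl
remaining 03∣12 1F a b c = contradiction refl c
remaining 03∣12 2F a b c = refl
remaining 03∣12 3F a b c = contradiction refl b

_≟ᴾ_ : DecidableEquality Pairing
01∣23 ≟ᴾ 01∣23 = yes refl
01∣23 ≟ᴾ 02∣13 = no λ ()
01∣23 ≟ᴾ 03∣12 = no λ ()
02∣13 ≟ᴾ 01∣23 = no λ ()
02∣13 ≟ᴾ 02∣13 = yes refl
02∣13 ≟ᴾ 03∣12 = no λ ()
03∣12 ≟ᴾ 01∣23 = no λ ()
03∣12 ≟ᴾ 02∣13 = no λ ()
03∣12 ≟ᴾ 03∣12 = yes refl

rotate : Pairing → Pairing
rotate 01∣23 = 02∣13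
rotate 02∣13 = 03∣12
rotate 03∣12 = 01∣23

rotate²≢ : ∀ p → rotate (rotate p) ≢ p
rotate²≢ 01∣23 ()
rotate²≢ 02∣13 ()
rotate²≢ 03∣12 ()

rotate≢ : ∀ p → rotate p ≢ p
rotate≢ 01∣23 ()
rotate≢ 02∣13 ()
rotate≢ 03∣12 ()

rotate-cover : ∀ p q → q ≡ p ⊎ q ≡ rotate p ⊎ q ≡ rotate (rotate p)
rotate-cover 01∣23 01∣23 = inj₁ refl
rotate-cover 01∣23 02∣13 = inj₂ (inj₁ refl)
rotate-cover 01∣23 03∣12 = inj₂ (inj₂ refl)
rotate-cover 02∣13 01∣23 = inj₂ (inj₂ refl)
rotate-cover 02∣13 02∣13 = inj₁ refl
rotate-cover 02∣13 03∣12 = inj₂ (inj₁ refl)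
rotate-cover 03∣12 01∣23 = inj₂ (inj₁ refl)
rotate-cover 03∣12 02∣13 = inj₂ (inj₂ refl)
rotate-cover 03∣12 03∣12 = inj₁ refl

-- An ordering of the three pairings, given by the first one and by whether
-- the others follow in the cyclic order of `rotate`.
Frame : Set
Frame = Pairing × Bool

first second third : Frame → Pairing
first  (p , _)     = p
second (p , true)  = rotate p
second (p , false) = rotate (rotate p)
third  (p , true)  = rotate (rotate p)
third  (p , false) = rotate p

first≢second : ∀ f → first f ≢ second f
first≢second (p , true)  = ≢-sym (rotate≢ p)
first≢second (p , false) = ≢-sym (rotate²≢ p)

first≢third : ∀ f → first f ≢ third f
first≢third (p , true)  = ≢-sym (rotate²≢ p)
first≢third (p , false) = ≢-sym (rotate≢ p)

second≢third : ∀ f → second f ≢ third f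
second≢third (p , true)  = ≢-sym (rotate≢ (rotate p))
second≢third (p , false) = rotate≢ (rotate p)

frame-cover : ∀ f q → q ≡ first f ⊎ q ≡ second f ⊎ q ≡ third f
frame-cover (p , true)  q = rotate-cover p q
frame-cover (p , false) q = Sum.map₂ Sum.swap (rotate-cover p q)

frame-of : ∀ {p q} → p ≢ q → ∃[ f ] first f ≡ p × second f ≡ q
frame-of {p} {q} p≢q with rotate-cover p q
... | inj₁ eq        = contradiction (sym eq) p≢q
... | inj₂ (inj₁ eq) = (p , true) , refl , sym eq
... | inj₂ (inj₂ eq) = (p , false) , refl , sym eq

-- Trails in a 4-regular graph and tightness

module _ (F : FourRegularGraph) where
  open FourRegularGraph F

  -- `cross` runs along an edge and `turn` passes through a vertex by its chosen transition. The
  -- classes generated are the half-edge sets of the components of F|_T other than free loops.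
  data Step (t : Vertex → Pairing) : Rel HalfEdge 0ℓ where
    cross : ∀ h → Step t h (mate h)
    turn  : ∀ v i → Step t (v , i) (v , partner (t v) i)

  -- Equivalent to k(F|_T) = k(F), for the transversal T given by t.
  Connecting : (Vertex → Pairing) → Set
  Connecting t = ∀ v i j → EqClosure (Step t) (v , i) (v , j)

  -- Connectivity along the trails that only pass through vertices in a list,
  -- as a sequence of joins so that the ends of the trails can be tracked.
  Trail : (Vertex → Pairing) → List Vertex → Rel HalfEdge 0ℓ
  Trail t []       g h = h ≡ g ⊎ h ≡ mate g
  Trail t (v ∷ vs) =
    Join (Join (Trail t vs) (v , 0F) (v , partner (t v) 0F))
         (v , outside₀ (t v)) (v , partner (t v) (outside₀ (t v)))

  trail-isEquivalence : ∀ t vs → IsEquivalence (Trail t vs)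
  trail-isEquivalence t []       = record
    { refl  = inj₁ refl
    ; sym   = λ where
        (inj₁ refl) → inj₁ refl
        (inj₂ refl) → inj₂ (sym (mate-involutive _))
    ; trans = λ where
        (inj₁ refl) q           → q
        (inj₂ refl) (inj₁ refl) → inj₂ refl
        (inj₂ refl) (inj₂ refl) → inj₁ (mate-involutive _)
    }
  trail-isEquivalence t (v ∷ vs) = join-isEquivalence (join-isEquivalence (trail-isEquivalence t vs))

  trail-cross : ∀ t vs h → Trail t vs h (mate h)
  trail-cross t []       h = inj₂ refl
  trail-cross t (v ∷ vs) h = inj₁ (inj₁ (trail-cross t vs h))

  trail-turn : ∀ t {vs v} → v ∈ˡ vs → ∀ i → Trail t vs (v , i) (v , partner (t v) i)
  trail-turn t {v ∷ vs} (there v∈vs) i = inj₁ (inj₁ (trail-turn t v∈vs i))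
  trail-turn t {v ∷ vs} (here refl)    =
    partner-generated
      (On.isEquivalence (v ,_) (trail-isEquivalence t (v ∷ vs)))
      (t v)
      (inj₁ (join-pair (trail-isEquivalence t vs)))
      (join-pair (join-isEquivalence (trail-isEquivalence t vs)))

  trail-least : {_≈_ : Rel HalfEdge 0ℓ} → IsEquivalence _≈_ → ∀ {t vs} →
                (∀ h → h ≈ mate h) →
                (∀ {v} → v ∈ˡ vs → ∀ i → (v , i) ≈ (v , partner (t v) i)) →
                Trail t vs ⇒ _≈_
  trail-least ≈-equiv {vs = []} c _ (inj₁ refl) = IsEquivalence.refl ≈-equiv
  trail-least ≈-equiv {vs = []} c _ (inj₂ refl) = c _
  trail-least ≈-equiv {vs = v ∷ vs} c d =
    join-least ≈-equiv
      (join-least ≈-equiv (trail-least ≈-equiv c (d ∘ there)) (d (here refl) _))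
      (d (here refl) _)

  _≟ᴴ_ : DecidableEquality HalfEdge
  _≟ᴴ_ = ≡-dec _≟_ _≟_

  -- Induction on the list. When no vertex may be passed, the trails are single edges and the other
  -- end is the mate. Admitting v joins its four half-edges in two pairs; they are still ends at
  -- that point because v does not occur in the rest of the list, and afterwards they are ends no
  -- longer.
  trail-paired : ∀ t {vs} → Unique vs → Paired (Trail t vs) (λ h → proj₁ h ∉ˡ vs)
  trail-paired t [] {h} _ =
    mate h , (λ ()) , mate-irreflexive h , inj₂ refl , λ _ p → p
  trail-paired t {v ∷ vs} (v∉vs ∷ vs!) {h} h∉ =
    let j≢k , l≢0 , l≢j = partner-≢ (t v)
        k≢0 , k≢j , k≢l = outside₀-≢ (t v)
        y , (((y∉vs , y≢0 , y≢j) , y≢k , y≢l) , y≢h , h~y , only) =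
          paired-join _≟ᴴ_ (join-isEquivalence (trail-isEquivalence t vs))
            (paired-join _≟ᴴ_ (trail-isEquivalence t vs) (trail-paired t vs!)
              {v , 0F} {v , partner (t v) 0F}
              v∉ v∉ (λ eq → j≢k (cong proj₂ eq)))
            {v , outside₀ (t v)} {v , partner (t v) (outside₀ (t v))}
            (v∉ , (λ eq → k≢0 (cong proj₂ eq)) , (λ eq → k≢j (cong proj₂ eq)))
            (v∉ , (λ eq → l≢0 (cong proj₂ eq)) , (λ eq → l≢j (cong proj₂ eq)))
            (λ eq → k≢l (cong proj₂ eq))
            {h} (restrict h h∉)
    in y , extend y y∉vs y≢0 y≢j y≢k y≢l , y≢h , h~y , λ z∉ → only (restrict _ z∉)
    where
    v∉ : v ∉ˡ vs
    v∉ v∈vs = All.lookup v∉vs v∈vs refl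

    restrict : ∀ h → proj₁ h ∉ˡ v ∷ vs → (((proj₁ h ∉ˡ vs) × h ≢ _ × h ≢ _) × h ≢ _ × h ≢ _)
    restrict h h∉ = ((h∉ ∘ there) , off , off) , off , off
      where
      off : ∀ {i} → h ≢ (v , i)
      off refl = h∉ (here refl)

    extend : ∀ h → proj₁ h ∉ˡ vs → h ≢ (v , 0F) → h ≢ (v , partner (t v) 0F) →
             h ≢ (v , outside₀ (t v)) → h ≢ (v , partner (t v) (outside₀ (t v))) →
             proj₁ h ∉ˡ v ∷ vs
    extend h       h∉vs _ _ _ _ (there p)   = h∉vs p
    extend (_ , i) h∉vs a b c d (here refl) =
      d (cong (v ,_) (remaining (t v) i (a ∘ cong (v ,_)) (b ∘ cong (v ,_)) (c ∘ cong (v ,_))))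

  module _ (v : Vertex) (t : Vertex → Pairing) where

    private
      -- All vertices except v, so that the only ends left are the four half-edges at v.
      vs : List Vertex
      vs = filter (λ w → ¬? (w ≟ v)) (allFin order)

      v∉vs : v ∉ˡ vs
      v∉vs v∈vs = proj₂ (∈-filter⁻ (λ w → ¬? (w ≟ v)) {xs = allFin order} v∈vs) refl

      vs! : Unique vs
      vs! = Uniqueₚ.filter⁺ _ (Uniqueₚ.allFin⁺ order)

      vs-off : ∀ {w} → w ∈ˡ vs → w ≢ v
      vs-off w∈vs = proj₂ (∈-filter⁻ (λ w → ¬? (w ≟ v)) {xs = allFin order} w∈vs)

      only-v : ∀ {w} → w ∉ˡ vs → w ≡ v
      only-v {w} w∉vs with w ≟ v
      ... | yes w≡v = w≡v
      ... | no w≢v  = contradiction (∈-filter⁺ (λ w → ¬? (w ≟ v)) (∈-allFin w) w≢v) w∉vs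

      _~_ : Rel HalfEdge 0ℓ
      _~_ = Trail t vs

      module ~ = IsEquivalence (trail-isEquivalence t vs)

      _~ᵥ_ : Rel (Fin 4) 0ℓ
      i ~ᵥ j = (v , i) ~ (v , j)

      ~ᵥ-equiv : IsEquivalence _~ᵥ_
      ~ᵥ-equiv = On.isEquivalence (v ,_) (trail-isEquivalence t vs)

      pairedᵥ : Paired _~ᵥ_ (λ _ → ⊤)
      pairedᵥ {i} _ with trail-paired t vs! {v , i} v∉vs
      ... | (w , j) , w∉vs , neq , p , only with refl ← only-v w∉vs =
        j , _ , neq ∘ cong (v ,_) , p , λ _ q → Sum.map (cong proj₂) (cong proj₂) (only v∉vs q)

    -- The four ends at v are matched by the trails, and the end reached from 0F fixes the pairing.
    -- Its two pairs lie on different trails, since a trail has only two ends; hence the four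
    -- half-edges are not all connected.
    return-pairing : ∃[ p ] (∀ i → i ~ᵥ partner p i) × ¬ (∀ i j → i ~ᵥ j)
    return-pairing with pairedᵥ {0F} _
    ... | j , _ , j≢0 , 0~j , only with pairing-of j j≢0
    ... | p , refl with outside₀-≢ p | pairedᵥ {outside₀ p} _
    ... | k≢0 , k≢j , _ | l , _ , l≢k , k~l , _ =
      p , partner-generated ~ᵥ-equiv p 0~j (subst (outside₀ p ~ᵥ_) l≡ k~l)
        , λ all → 0≁k (all 0F (outside₀ p))
      where
      0≁k : ¬ (0F ~ᵥ outside₀ p)
      0≁k q with only _ q
      ... | inj₁ eq = k≢0 eq
      ... | inj₂ eq = k≢j eq
      l≡ : l ≡ partner p (outside₀ p)
      l≡ = remaining p l (λ { refl → 0≁k (~.sym k~l) })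
             (λ { refl → 0≁k (~.trans 0~j (~.sym k~l)) }) l≢k

    AgreesOff : (Vertex → Pairing) → Set
    AgreesOff t′ = ∀ w → w ≢ v → t w ≡ t′ w

    private
      ~⊆ : ∀ t′ → AgreesOff t′ → _~_ ⇒ EqClosure (Step t′)
      ~⊆ t′ agree = trail-least (EqC.isEquivalence _) (EqC.return ∘ cross)
        (λ {w} w∈vs i → EqC.return (subst (λ p → Step t′ (w , i) (w , partner p i))
           (sym (agree w (vs-off w∈vs))) (turn w i)))

      -- Every step of t′ either avoids turning at v, and is then contained in `_~_`, or is one of
      -- the turns at v.
      least : {_≈_ : Rel HalfEdge 0ℓ} → IsEquivalence _≈_ → ∀ {t′} → AgreesOff t′ →
              _~_ ⇒ _≈_ → (∀ i → (v , i) ≈ (v , partner (t′ v) i)) → EqClosure (Step t′) ⇒ _≈_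
      least {_≈_} ≈-equiv {t′} agree ~⇒≈ at-v = EqC.fold ≈-equiv step
        where
        at : ∀ w i → (w , i) ≈ (w , partner (t′ w) i)
        at w i with w ≟ v
        ... | yes refl = at-v i
        ... | no w≢v   = ~⇒≈ (subst (λ p → (w , i) ~ (w , partner p i)) (agree w w≢v)
                (trail-turn t (∈-filter⁺ (λ w → ¬? (w ≟ v)) (∈-allFin w) w≢v) i))
        step : Step t′ ⇒ _≈_
        step (cross h)  = ~⇒≈ (trail-cross t vs h)
        step (turn w i) = at w i

    -- The pairing is the one by which the trails return. Choosing it at v closes the two trails
    -- separately. Any other choice forms a 4-cycle with it, so all half-edges at v become
    -- connected; a turn at v made by t′ can then be simulated in t″, and connectivity passes from
    -- one choice to the other.
    disconnecting-pairing :
      ∃[ p ] (∀ t′ → AgreesOff t′ → t′ v ≡ p → ¬ Connecting t′)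
           × (∀ t′ t″ → AgreesOff t′ → AgreesOff t″ → t′ v ≢ p → t″ v ≢ p →
                Connecting t′ → Connecting t″)
    disconnecting-pairing with return-pairing
    ... | p , P , not-all = p , bad , good
      where
      bad : ∀ t′ → AgreesOff t′ → t′ v ≡ p → ¬ Connecting t′
      bad t′ agree refl conn = not-all λ i j →
        least (trail-isEquivalence t vs) agree id P (conn v i j)

      good : ∀ t′ t″ → AgreesOff t′ → AgreesOff t″ → t′ v ≢ p → t″ v ≢ p →
             Connecting t′ → Connecting t″
      good t′ t″ agree′ agree″ _ t″v≢p conn w i j =
        least (EqC.isEquivalence _) agree′ (~⊆ t″ agree″)
          (λ i → all i (partner (t′ v) i)) (conn w i j)
        where
        all : ∀ i j → EqClosure (Step t″) (v , i) (v , j)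
        all = two-pairings-connect (On.isEquivalence (v ,_) (EqC.isEquivalence (Step t″)))
          t″v≢p (λ i → EqC.return (turn v i)) (λ i → ~⊆ t″ agree″ (P i))

  -- Tightness: the number of connecting transitions at v is 0 or 2.
  connecting-third : ∀ v f {t₁ t₂ t₃} →
    (∀ w → w ≢ v → t₁ w ≡ t₂ w) → (∀ w → w ≢ v → t₁ w ≡ t₃ w) →
    t₁ v ≡ first f → t₂ v ≡ second f → t₃ v ≡ third f →
    Connecting t₃ ⇔ ((Connecting t₂ × ¬ Connecting t₁) ⊎ (Connecting t₁ × ¬ Connecting t₂))
  connecting-third v f {t₁} {t₂} {t₃} e₂ e₃ eq₁ eq₂ eq₃ with disconnecting-pairing v t₁
  -- The disconnecting p is one of the three transitions, and the other two connect or fail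
  -- together. If p is the third, the first two agree and both summands on the right are impossible.
  ... | p , bad , good with frame-cover f p
  ... | inj₁ p≡ = mk⇔
    (λ c → inj₁ (good t₃ t₂ e₃ e₂ t₃≢p t₂≢p c , ¬c₁))
    λ where
      (inj₁ (c₂ , _)) → good t₂ t₃ e₂ e₃ t₂≢p t₃≢p c₂
      (inj₂ (c₁ , _)) → contradiction c₁ ¬c₁
    where
    t₂≢p : t₂ v ≢ p
    t₂≢p eq = first≢second f (trans (sym p≡) (trans (sym eq) eq₂))
    t₃≢p : t₃ v ≢ p
    t₃≢p eq = first≢third f (trans (sym p≡) (trans (sym eq) eq₃))
    ¬c₁ : ¬ Connecting t₁
    ¬c₁ = bad t₁ (λ _ _ → refl) (trans eq₁ (sym p≡))
  ... | inj₂ (inj₁ p≡) = mk⇔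
    (λ c → inj₂ (good t₃ t₁ e₃ (λ _ _ → refl) t₃≢p t₁≢p c , ¬c₂))
    λ where
      (inj₁ (c₂ , _)) → contradiction c₂ ¬c₂
      (inj₂ (c₁ , _)) → good t₁ t₃ (λ _ _ → refl) e₃ t₁≢p t₃≢p c₁
    where
    t₁≢p : t₁ v ≢ p
    t₁≢p eq = first≢second f (trans (sym eq₁) (trans eq p≡))
    t₃≢p : t₃ v ≢ p
    t₃≢p eq = second≢third f (trans (sym p≡) (trans (sym eq) eq₃))
    ¬c₂ : ¬ Connecting t₂
    ¬c₂ = bad t₂ e₂ (trans eq₂ (sym p≡))
  ... | inj₂ (inj₂ p≡) = mk⇔
    (λ c → contradiction c (bad t₃ e₃ (trans eq₃ (sym p≡))))
    λ where
      (inj₁ (c₂ , ¬c₁)) → contradiction (good t₂ t₁ e₂ (λ _ _ → refl) t₂≢p t₁≢p c₂) ¬c₁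
      (inj₂ (c₁ , ¬c₂)) → contradiction (good t₁ t₂ (λ _ _ → refl) e₂ t₁≢p t₂≢p c₁) ¬c₂
    where
    t₁≢p : t₁ v ≢ p
    t₁≢p eq = first≢third f (trans (sym eq₁) (trans eq p≡))
    t₂≢p : t₂ v ≢ p
    t₂≢p eq = second≢third f (trans (sym eq₂) (trans eq p≡))

-- Bases of the 3-matroid as connecting choices of transitions

part-injective : ∀ p i j → part p i ≡ part p j → j ≡ i ⊎ j ≡ partner p i
part-injective = cases
  where
  holds? : ∀ p → Dec (∀ i j → part p i ≡ part p j → j ≡ i ⊎ j ≡ partner p i)
  holds? p = all? λ i → all? λ j →
    (part p i ≟ part p j) →-dec ((j ≟ i) ⊎-dec (j ≟ partner p i))
  cases : ∀ p i j → part p i ≡ part p j → j ≡ i ⊎ j ≡ partner p i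
  cases 01∣23 = from-yes (holds? 01∣23)
  cases 02∣13 = from-yes (holds? 02∣13)
  cases 03∣12 = from-yes (holds? 03∣12)

part-surjective : ∀ p c → ∃[ i ] part p i ≡ c
part-surjective p     0F = 0F , part-0F p
  where
  part-0F : ∀ p → part p 0F ≡ 0F
  part-0F 01∣23 = refl
  part-0F 02∣13 = refl
  part-0F 03∣12 = refl
part-surjective p     1F = outside₀ p , part-outside₀ p
  where
  part-outside₀ : ∀ p → part p (outside₀ p) ≡ 1F
  part-outside₀ 01∣23 = refl
  part-outside₀ 02∣13 = refl
  part-outside₀ 03∣12 = refl

choose : Frame → Bool → Pairing
choose f b = if b then second f else first f

module _ (F : FourRegularGraph) where
  open FourRegularGraph F

  private
    Split : (Vertex → Pairing) → Rel ((Vertex × Fin 2) ⊎ FreeLoop) 0ℓ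
    Split t = Linked (split F t)

    module _ {t : Vertex → Pairing} where

      atₜ : HalfEdge → (Vertex × Fin 2) ⊎ FreeLoop
      atₜ h = inj₁ (Graph.at (split F t) h)

      step⇒split : ∀ {g h} → EqClosure (Step F t) g h → EqClosure (Split t) (atₜ g) (atₜ h)
      step⇒split = EqC.gfold ≈-equiv atₜ λ where
          (cross h)  → EqC.return (link h)
          (turn v i) → ≈.reflexive (cong (inj₁ ∘ (v ,_)) (sym (part-partner (t v) i)))
        where
        ≈-equiv = EqC.isEquivalence (Split t)
        module ≈ = IsEquivalence ≈-equiv

      module ~ = IsEquivalence (EqC.isEquivalence (Step F t))

      same-end : ∀ {g h} → atₜ g ≡ atₜ h → EqClosure (Step F t) g h
      same-end {v , i} {w , j} eq with cong proj₁ (inj₁-injective eq)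
      ... | refl with part-injective (t v) i j (cong proj₂ (inj₁-injective eq))
      ... | inj₁ refl = ~.refl
      ... | inj₂ refl = EqC.return (turn v i)

      -- The endpoints range over all half-edges lying over x and y, because a path in the split
      -- graph may enter a vertex by one half-edge and leave it by another.
      split⇒step : ∀ {x y} → EqClosure (Split t) x y → ∀ {g h} → atₜ g ≡ x → atₜ h ≡ y →
                   EqClosure (Step F t) g h
      split⇒step ε                    refl eq = same-end (sym eq)
      split⇒step (fwd (link k) ◅ ps) g≡ h≡ =
        ~.trans (same-end g≡) (~.trans (EqC.return (cross k)) (split⇒step ps refl h≡))
      split⇒step (bwd (link k) ◅ ps) g≡ h≡ =
        ~.trans (same-end g≡) (~.trans (~.sym (EqC.return (cross k))) (split⇒step ps refl h≡))

  unsplit : (Vertex × Fin 2) ⊎ FreeLoop → Vertex ⊎ FreeLoop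
  unsplit = Sum.map₁ proj₁

  unsplit-linked : ∀ {t x y} → EqClosure (Linked (split F t)) x y →
                   EqClosure (Linked graph) (unsplit x) (unsplit y)
  unsplit-linked = EqC.gmap unsplit λ { (link h) → link h }

  -- A path lifts edge by edge. Where consecutive edges meet different halves of a split vertex,
  -- `Connecting` supplies the detour between the halves.
  connecting-lifts : ∀ {t} → Connecting F t → ∀ {u w} → EqClosure (Linked graph) u w →
    ∀ {x y} → unsplit x ≡ u → unsplit y ≡ w → EqClosure (Linked (split F t)) x y
  connecting-lifts {t} conn = lift
    where
    module ≈ = IsEquivalence (EqC.isEquivalence (Split t))
    same-vertex : ∀ {x y} → unsplit x ≡ unsplit y → EqClosure (Split t) x y
    same-vertex {inj₁ (v , c)} {inj₁ (.v , d)} refl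
      with part-surjective (t v) c | part-surjective (t v) d
    ... | i , refl | j , refl = step⇒split (conn v i j)
    same-vertex {inj₂ _} {inj₂ _} refl = ≈.refl
    lift : ∀ {u w} → EqClosure (Linked graph) u w →
           ∀ {x y} → unsplit x ≡ u → unsplit y ≡ w → EqClosure (Split t) x y
    lift ε                    refl eq = same-vertex (sym eq)
    lift (fwd (link k) ◅ ps) x≡ y≡ =
      ≈.trans (same-vertex x≡) (≈.trans (EqC.return (link k)) (lift ps refl y≡))
    lift (bwd (link k) ◅ ps) x≡ y≡ =
      ≈.trans (same-vertex x≡) (≈.trans (≈.sym (EqC.return (link k))) (lift ps refl y≡))

  connecting⇒sameNumber : ∀ {t} → ∃ (Linked graph HasClasses_) → Connecting F t →
                          SameNumberOfClasses (Linked (split F t)) (Linked graph)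
  connecting⇒sameNumber {t} (k , f , f-surj , f-classes) conn =
    k , (f ∘ unsplit
          , (λ c → let x , fx≡c = f-surj c in
                 lift x , λ { refl → trans (cong f (unsplit-lift x)) (fx≡c refl) })
          , λ x y → mk⇔ (to (f-classes _ _) ∘ unsplit-linked)
                        (λ eq → connecting-lifts conn (from (f-classes _ _) eq) refl refl))
      , (f , f-surj , f-classes)
    where
    lift : Vertex ⊎ FreeLoop → (Vertex × Fin 2) ⊎ FreeLoop
    lift = Sum.map₁ (_, 0F)
    unsplit-lift : ∀ x → unsplit (lift x) ≡ x
    unsplit-lift (inj₁ _) = refl
    unsplit-lift (inj₂ _) = refl

  -- With k classes on both sides, the surjection that `unsplit` induces on
  -- classes is injective.
  sameNumber⇒connecting : ∀ {t} → SameNumberOfClasses (Linked (split F t)) (Linked graph) →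
                          Connecting F t
  sameNumber⇒connecting {t} (k , (f , f-surj , f-classes) , (g , g-surj , g-classes)) v i j =
    split⇒step
      (from (f-classes _ _) (surjective⇒injective ψ-surj (trans (ψ∘f _) (sym (ψ∘f _))))) refl refl
    where
    ψ : Fin k → Fin k
    ψ = g ∘ unsplit ∘ proj₁ ∘ f-surj

    ψ∘f : ∀ x → ψ (f x) ≡ g (unsplit x)
    ψ∘f x = to (g-classes _ _) (unsplit-linked (from (f-classes _ _) (proj₂ (f-surj (f x)) refl)))

    ψ-surj : ∀ c → ∃ λ z → ∀ {w} → w ≡ z → ψ w ≡ c
    ψ-surj c with g-surj c
    ... | inj₁ v , gv≡c = f (inj₁ (v , 0F)) , λ { refl → trans (ψ∘f _) (gv≡c refl) }
    ... | inj₂ l , gl≡c = f (inj₂ l) , λ { refl → trans (ψ∘f _) (gl≡c refl) }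

  Selects : FSet (Vertex × Pairing) → (Vertex → Pairing) → Set
  Selects T t = ∀ v q → (v , q) ∈ T ⇔ q ≡ t v

  transversal⇒selects : ∀ {T} → IsTransversal (transitions F) T → ∃ (Selects T)
  transversal⇒selects {T} T-trans = t , λ v q → mk⇔ (to′ v q) (from′ v q)
    where
    t : Vertex → Pairing
    t v = proj₂ (proj₁ (T-trans (v , 01∣23)))
    to′ : ∀ v q → (v , q) ∈ T → q ≡ t v
    to′ v q q∈T = sym (cong proj₂ (proj₂ (proj₂ (T-trans (v , 01∣23))) (refl , q∈T)))
    from′ : ∀ v q → q ≡ t v → (v , q) ∈ T
    from′ v q refl with T-trans (v , 01∣23)
    ... | _ , (refl , tv∈T) , _ = tv∈T

  selects⇒transversal : ∀ {T t} → Selects T t → IsTransversal (transitions F) T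
  selects⇒transversal {T} {t} sel (v , _) =
    (v , t v) , (refl , from (sel v _) refl) ,
    λ { {_ , q} (refl , q∈T) → cong (v ,_) (sym (to (sel v q) q∈T)) }

  selection : (Vertex → Pairing) → FSet (Vertex × Pairing)
  selection t (v , q) = does (q ≟ᴾ t v)

  selection-selects : ∀ t → Selects (selection t) t
  selection-selects t v q with q ≟ᴾ t v
  ... | yes q≡ = mk⇔ (λ _ → q≡) (λ _ → refl)
  ... | no q≢  = mk⇔ (λ ()) (λ q≡ → contradiction q≡ q≢)

  -- An independent B lies in some member of `𝓑`, which is itself independent, so maximality makes B
  -- equal to it.
  basis⇒connecting : ∀ {B} → MultimatroidData.IsBasis (Z F) B → ∃[ t ] Selects B t × Connecting F t
  basis⇒connecting {B} ((B′ , B′∈𝓑@(B′-trans , t , t∈B′ , same) , B⊆B′) , maximal)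
    with transversal⇒selects B′-trans
  ... | s , sel = t , sel′ , sameNumber⇒connecting same
    where
    B′⊆B : B′ ⊆ B
    B′⊆B = maximal B′ (B′ , B′∈𝓑 , id) B⊆B′
    sel′ : Selects B t
    sel′ v q = mk⇔
      (λ q∈B → trans (to (sel v q) (B⊆B′ q∈B)) (sym (to (sel v _) (t∈B′ v))))
      (λ { refl → B′⊆B (t∈B′ v) })

  -- Maximality holds because an independent J lies in a transversal: if J contains B, its
  -- transition at each vertex must be the one in B.
  connecting⇒basis : ∃ (Linked graph HasClasses_) → ∀ {B t} → Selects B t → Connecting F t →
                     MultimatroidData.IsBasis (Z F) B
  connecting⇒basis classes {B} {t} sel conn =
    (B , (selects⇒transversal sel , t , (λ v → from (sel v _) refl)
       , connecting⇒sameNumber classes conn) , id)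
    , maximal
    where
    maximal : ∀ J → MultimatroidData.Independent (Z F) J → B ⊆ J → J ⊆ B
    maximal J (B″ , (B″-trans , _) , J⊆B″) B⊆J {v , q} q∈J with transversal⇒selects B″-trans
    ... | s , sel″ = from (sel v q) (trans (to (sel″ v q) (J⊆B″ q∈J))
                       (sym (to (sel″ v _) (J⊆B″ (B⊆J (from (sel v _) refl))))))


  Frames : Set
  Frames = Vertex → Frame

  frameSystem : ∀ {n} → (Vertex ↔ Fin n) → Frames → SetSystem n
  frameSystem ρ s Y = Connecting F (λ v → choose (s v) (lookup Y (Inverse.to ρ v)))

-- Subsets, and the group action up to equality of set systems

module _ {n : ℕ} where

  ∈⇒lookup : ∀ {X : Subset n} {i} → i Sub.∈ X → lookup X i ≡ true
  ∈⇒lookup = []=⇒lookup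

  lookup⇒∈ : ∀ {X : Subset n} {i} → lookup X i ≡ true → i Sub.∈ X
  lookup⇒∈ {X} {i} = lookup⇒[]= i X

  ∉⇒lookup : ∀ {X : Subset n} {i} → ¬ (i Sub.∈ X) → lookup X i ≡ false
  ∉⇒lookup i∉X = ¬-not (i∉X ∘ lookup⇒∈)

  subset-ext : {X Y : Subset n} → (∀ i → lookup X i ≡ lookup Y i) → X ≡ Y
  subset-ext eq = Pointwise-≡⇒≡ (ext eq)

lookup-△ : ∀ {n} (X Y : Subset n) i → lookup (X △ Y) i ≡ lookup X i xor lookup Y i
lookup-△ (true  ∷ _) (true  ∷ _) zero    = refl
lookup-△ (true  ∷ _) (false ∷ _) zero    = refl
lookup-△ (false ∷ _) (true  ∷ _) zero    = refl
lookup-△ (false ∷ _) (false ∷ _) zero    = refl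
lookup-△ (_     ∷ X) (_     ∷ Y) (suc i) = lookup-△ X Y i

module _ {n : ℕ} where

  lookup-△⁅⁆-≡ : ∀ (X : Subset n) i → lookup (X △ ⁅ i ⁆) i ≡ lookup X i xor true
  lookup-△⁅⁆-≡ X i = trans (lookup-△ X ⁅ i ⁆ i) (cong (lookup X i xor_) (∈⇒lookup (x∈⁅x⁆ i)))

  lookup-△⁅⁆-≢ : ∀ (X : Subset n) {i j} → j ≢ i → lookup (X △ ⁅ i ⁆) j ≡ lookup X j
  lookup-△⁅⁆-≢ X {i} {j} j≢i = trans (lookup-△ X ⁅ i ⁆ j)
    (trans (cong (lookup X j xor_) (∉⇒lookup (x≢y⇒x∉⁅y⁆ j≢i))) (xor-identityʳ _))

  △-involutive : ∀ (X : Subset n) i → X ≡ (X △ ⁅ i ⁆) △ ⁅ i ⁆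
  △-involutive X i = subset-ext eq
    where
    xor-true² : ∀ b → b ≡ (b xor true) xor true
    xor-true² true  = refl
    xor-true² false = refl
    eq : ∀ j → lookup X j ≡ lookup ((X △ ⁅ i ⁆) △ ⁅ i ⁆) j
    eq j with j ≟ i
    ... | yes refl = trans (xor-true² _) (sym (trans (lookup-△⁅⁆-≡ (X △ ⁅ i ⁆) i)
      (cong (_xor true) (lookup-△⁅⁆-≡ X i))))
    ... | no j≢i   = sym (trans (lookup-△⁅⁆-≢ (X △ ⁅ i ⁆) j≢i) (lookup-△⁅⁆-≢ X j≢i))

  lookup-∪⁅⁆-≡ : ∀ (X : Subset n) i → lookup (X Sub.∪ ⁅ i ⁆) i ≡ true
  lookup-∪⁅⁆-≡ X i = trans (lookup-zipWith _∨_ i X ⁅ i ⁆)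
    (trans (cong (lookup X i ∨_) (∈⇒lookup (x∈⁅x⁆ i))) (∨-zeroʳ _))

  lookup-∪⁅⁆-≢ : ∀ (X : Subset n) {i j} → j ≢ i → lookup (X Sub.∪ ⁅ i ⁆) j ≡ lookup X j
  lookup-∪⁅⁆-≢ X {i} {j} j≢i = trans (lookup-zipWith _∨_ j X ⁅ i ⁆)
    (trans (cong (lookup X j ∨_) (∉⇒lookup (x≢y⇒x∉⁅y⁆ j≢i))) (∨-identityʳ _))

  △-∪-cancel : ∀ {X : Subset n} {i} → lookup X i ≡ false → X ≡ (X Sub.∪ ⁅ i ⁆) △ ⁅ i ⁆
  △-∪-cancel {X} {i} off = subset-ext eq
    where
    eq : ∀ j → lookup X j ≡ lookup ((X Sub.∪ ⁅ i ⁆) △ ⁅ i ⁆) j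
    eq j with j ≟ i
    ... | yes refl = trans off (sym (trans (lookup-△⁅⁆-≡ (X Sub.∪ ⁅ i ⁆) i)
      (cong (_xor true) (lookup-∪⁅⁆-≡ X i))))
    ... | no j≢i   = sym (trans (lookup-△⁅⁆-≢ (X Sub.∪ ⁅ i ⁆) j≢i) (lookup-∪⁅⁆-≢ X j≢i))

  ∪-△-cancel : ∀ {X : Subset n} {i} → lookup X i ≡ true → X ≡ (X △ ⁅ i ⁆) Sub.∪ ⁅ i ⁆
  ∪-△-cancel {X} {i} on = subset-ext eq
    where
    eq : ∀ j → lookup X j ≡ lookup ((X △ ⁅ i ⁆) Sub.∪ ⁅ i ⁆) j
    eq j with j ≟ i
    ... | yes refl = trans on (sym (lookup-∪⁅⁆-≡ (X △ ⁅ i ⁆) i))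
    ... | no j≢i   = sym (trans (lookup-∪⁅⁆-≢ (X △ ⁅ i ⁆) j≢i) (lookup-△⁅⁆-≢ X j≢i))

  -- Both inclusions between D and D′ are assumed, because the symmetric difference in + also uses
  -- non-membership in D.
  applyGenerator-mono : ∀ a i {D D′ : SetSystem n} → D ≐ D′ →
                        ∀ {Y} → applyGenerator a i D Y → applyGenerator a i D′ Y
  applyGenerator-mono ∗ i (D⊆ , _)   (X , X∈D , eq) = X , D⊆ X∈D , eq
  applyGenerator-mono + i (D⊆ , ⊇D)  (inj₁ (Y∈D , none)) =
    inj₁ (D⊆ Y∈D , λ { (I , I∈D′ , rest) → none (I , ⊇D I∈D′ , rest) })
  applyGenerator-mono + i (D⊆ , ⊇D)  (inj₂ ((I , I∈D , rest) , Y∉D)) =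
    inj₂ ((I , D⊆ I∈D , rest) , Y∉D ∘ ⊇D)

  applyGenerator-cong : ∀ a i {D D′ : SetSystem n} → D ≐ D′ →
                        applyGenerator a i D ≐ applyGenerator a i D′
  applyGenerator-cong a i eq = applyGenerator-mono a i eq , applyGenerator-mono a i (≐-sym eq)

  applyWord-cong : ∀ w i {D D′ : SetSystem n} → D ≐ D′ → applyWord w i D ≐ applyWord w i D′
  applyWord-cong []      i eq = eq
  applyWord-cong (a ∷ w) i eq = applyGenerator-cong a i (applyWord-cong w i eq)

  ·-cong : ∀ ĝ {D D′ : SetSystem n} → D ≐ D′ → (ĝ · D) ≐ (ĝ · D′)
  ·-cong ĝ {D} {D′} eq = go (allFin n)
    where
    go : ∀ is → foldr (λ i → applyWord (ĝ i) i) D is ≐ foldr (λ i → applyWord (ĝ i) i) D′ is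
    go []       = eq
    go (i ∷ is) = applyWord-cong (ĝ i) i (go is)

  relabel-cong : ∀ (π : Permutation′ n) {D D′ : SetSystem n} → D ≐ D′ → relabel π D ≐ relabel π D′
  relabel-cong π (D⊆ , ⊇D) =
    (λ (I , I∈D , img) → I , D⊆ I∈D , img) , (λ (I , I∈D , img) → I , ⊇D I∈D , img)

actGenerator : Generator → Frame → Frame
actGenerator ∗ (p , true)  = rotate p , false
actGenerator ∗ (p , false) = rotate (rotate p) , true
actGenerator + (p , b)     = p , not b

actWord : Word → Frame → Frame
actWord w f = foldr actGenerator f w

choose-∗ : ∀ f b → choose f b ≡ choose (actGenerator ∗ f) (b xor true)
choose-∗ (01∣23 , true)  = λ { true → refl ; false → refl }
choose-∗ (01∣23 , false) = λ { true → refl ; false → refl }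
choose-∗ (02∣13 , true)  = λ { true → refl ; false → refl }
choose-∗ (02∣13 , false) = λ { true → refl ; false → refl }
choose-∗ (03∣12 , true)  = λ { true → refl ; false → refl }
choose-∗ (03∣12 , false) = λ { true → refl ; false → refl }

second-+ : ∀ f → second (actGenerator + f) ≡ third f
second-+ (_ , true)  = refl
second-+ (_ , false) = refl

private
  base : Frame
  base = 01∣23 , true

  to-base : ∀ f → ∃[ w ] actWord w f ≡ base
  to-base (01∣23 , true)  = [] , refl
  to-base (01∣23 , false) = + ∷ [] , refl
  to-base (02∣13 , true)  = ∗ ∷ + ∷ [] , refl
  to-base (02∣13 , false) = ∗ ∷ [] , refl
  to-base (03∣12 , true)  = + ∷ ∗ ∷ [] , refl
  to-base (03∣12 , false) = ∗ ∷ + ∷ ∗ ∷ [] , refl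

  from-base : ∀ f → ∃[ w ] actWord w base ≡ f
  from-base (01∣23 , true)  = [] , refl
  from-base (01∣23 , false) = + ∷ [] , refl
  from-base (02∣13 , true)  = + ∷ ∗ ∷ [] , refl
  from-base (02∣13 , false) = ∗ ∷ [] , refl
  from-base (03∣12 , true)  = ∗ ∷ + ∷ [] , refl
  from-base (03∣12 , false) = + ∷ ∗ ∷ + ∷ [] , refl

-- The detour through `base` needs six words each way instead of one for each of the thirty-six
-- pairs. The last letter acts first, so the word leading to `base` stands on the right.
actWord-transitive : ∀ f g → ∃[ w ] actWord w f ≡ g
actWord-transitive f g with to-base f | from-base g
... | u , u≡ | w , w≡ = w ++ u ,
  trans (foldr-++ actGenerator f w u) (trans (cong (actWord w) u≡) w≡)

-- The group action on frame systems

module _ (F : FourRegularGraph) where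
  open FourRegularGraph F

  connecting-cong : ∀ {t t′} → t ≗ t′ → Connecting F t → Connecting F t′
  connecting-cong {t} {t′} t≗t′ conn v i j = EqC.map step (conn v i j)
    where
    step : Step F t ⇒ Step F t′
    step (cross h)  = cross h
    step (turn v i) = subst (λ p → Step F t′ (v , i) (v , partner p i)) (sym (t≗t′ v)) (turn v i)

  module _ {n : ℕ} where

    frameSystem-cong : ∀ (ρ ρ′ : Vertex ↔ Fin n) → Inverse.to ρ ≗ Inverse.to ρ′ →
                       ∀ {s s′} → s ≗ s′ → frameSystem F ρ s ≐ frameSystem F ρ′ s′
    frameSystem-cong ρ ρ′ ρ≗ρ′ s≗s′ =
      (λ {Y} → connecting-cong (λ v → cong₂ choose (s≗s′ v) (cong (lookup Y) (ρ≗ρ′ v)))) ,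
      (λ {Y} → connecting-cong (λ v → sym (cong₂ choose (s≗s′ v) (cong (lookup Y) (ρ≗ρ′ v)))))

    relabel-frameSystem : ∀ (ρ : Vertex ↔ Fin n) (π : Permutation′ n) s →
                          relabel π (frameSystem F ρ s) ≐ frameSystem F (ρ ∘ₚ π) s
    relabel-frameSystem ρ π s = image-of , preimage
      where
      image-of : ∀ {Y} → relabel π (frameSystem F ρ s) Y → frameSystem F (ρ ∘ₚ π) s Y
      image-of {Y} (I , conn , img) = connecting-cong (λ v → cong (choose (s v)) (moved _)) conn
        where
        moved : ∀ j → lookup I j ≡ lookup Y (π ⟨$⟩ʳ j)
        moved j = ⇔→≡ (mk⇔
          (λ j∈I → ∈⇒lookup (from (img _) (j , lookup⇒∈ j∈I , refl)))
          (λ πj∈Y → let x , x∈I , πx≡πj = to (img _) (lookup⇒∈ πj∈Y)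
                    in subst (λ x → lookup I x ≡ true) (Injection.injective (↔⇒↣ π) πx≡πj)
                         (∈⇒lookup x∈I)))

      preimage : ∀ {Y} → frameSystem F (ρ ∘ₚ π) s Y → relabel π (frameSystem F ρ s) Y
      preimage {Y} conn = I , connecting-cong (λ v → cong (choose (s v)) (sym (lookup-I _))) conn , λ i → mk⇔
          (λ i∈Y → π ⟨$⟩ˡ i
                 , lookup⇒∈ (trans (lookup-I _)
                     (trans (cong (lookup Y) (Inverse.strictlyInverseˡ π i)) (∈⇒lookup i∈Y)))
                 , Inverse.strictlyInverseˡ π i)
          (λ { (x , x∈I , refl) → lookup⇒∈ (trans (sym (lookup-I x)) (∈⇒lookup x∈I)) })
        where
        I : Subset n
        I = tabulate (λ j → lookup Y (π ⟨$⟩ʳ j))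
        lookup-I : ∀ j → lookup I j ≡ lookup Y (π ⟨$⟩ʳ j)
        lookup-I = lookup∘tabulate _

    module _ (ρ : Vertex ↔ Fin n) where
      open Inverse ρ using () renaming (to to ρ→; from to ρ←)

      modify : Fin n → (Frame → Frame) → Frames F → Frames F
      modify i φ s v with ρ→ v ≟ i
      ... | yes _ = φ (s v)
      ... | no _  = s v

      modify-≡ : ∀ i φ s v → ρ→ v ≡ i → modify i φ s v ≡ φ (s v)
      modify-≡ i φ s v eq with ρ→ v ≟ i
      ... | yes _  = refl
      ... | no neq = contradiction eq neq

      modify-≢ : ∀ i φ s v → ρ→ v ≢ i → modify i φ s v ≡ s v
      modify-≢ i φ s v neq with ρ→ v ≟ i
      ... | yes eq = contradiction eq neq
      ... | no _   = refl

      chosen : Frames F → Subset n → Vertex → Pairing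
      chosen s Y v = choose (s v) (lookup Y (ρ→ v))

      chosen-∗ : ∀ i s X → chosen s X ≗ chosen (modify i (actGenerator ∗) s) (X △ ⁅ i ⁆)
      chosen-∗ i s X v with ρ→ v ≟ i
      ... | yes refl = trans (choose-∗ (s v) _)
        (cong (choose (actGenerator ∗ (s v))) (sym (lookup-△⁅⁆-≡ X i)))
      ... | no ρv≢i  = cong (choose (s v)) (sym (lookup-△⁅⁆-≢ X ρv≢i))

      ∗-frameSystem : ∀ i s → applyGenerator ∗ i (frameSystem F ρ s)
                            ≐ frameSystem F ρ (modify i (actGenerator ∗) s)
      ∗-frameSystem i s =
        (λ { (X , conn , refl) → connecting-cong (chosen-∗ i s X) conn }) ,
        (λ {Y} conn → Y △ ⁅ i ⁆
          , connecting-cong (λ v → sym (trans (chosen-∗ i s (Y △ ⁅ i ⁆) v)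
              (cong (λ Z → chosen (modify i (actGenerator ∗) s) Z v) (sym (△-involutive Y i))))) conn
          , △-involutive Y i)

      -- If i is not in Y, no set of the form I ∪ {i} equals Y, and the first transition, which +
      -- keeps, is used at u. If i is in Y, the transversals of Y without i, of Y, and of Y in the
      -- new frames agree away from u and use the first, second and third transition there, so
      -- tightness is the symmetric difference.
      +-frameSystem : ∀ i s → applyGenerator + i (frameSystem F ρ s)
                            ≐ frameSystem F ρ (modify i (actGenerator +) s)
      +-frameSystem i s = (λ {Y} → to (pointwise Y)) , (λ {Y} → from (pointwise Y))
        where
        s⁺ : Frames F
        s⁺ = modify i (actGenerator +) s

        u : Vertex
        u = ρ← i

        ρu≡i : ρ→ u ≡ i
        ρu≡i = Inverse.strictlyInverseˡ ρ i

        off-u : ∀ {v} → v ≢ u → ρ→ v ≢ i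
        off-u v≢u refl = v≢u (sym (Inverse.strictlyInverseʳ ρ _))

        pointwise : ∀ Y → applyGenerator + i (frameSystem F ρ s) Y ⇔ frameSystem F ρ s⁺ Y
        pointwise Y with lookup Y i in eq
        ... | false = mk⇔
          (λ { (inj₁ (conn , _)) → connecting-cong same conn
             ; (inj₂ ((I , _ , _ , Y≡) , _)) → contradiction Y≡ (not-added I) })
          (λ conn → inj₁ (connecting-cong (sym ∘ same) conn , λ { (I , _ , _ , Y≡) → not-added I Y≡ }))
          where
          same : chosen s Y ≗ chosen s⁺ Y
          same v with ρ→ v ≟ i
          ... | yes refl rewrite eq = refl
          ... | no _  = refl
          not-added : ∀ I → Y ≢ I Sub.∪ ⁅ i ⁆
          not-added I refl with trans (sym eq) (lookup-∪⁅⁆-≡ I i)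
          ... | ()
        ... | true = mk⇔
          (λ { (inj₁ (conn , none)) → from tight (inj₁ (conn , none ∘ added))
             ; (inj₂ (some , ¬conn)) → from tight (inj₂ (remove some , ¬conn)) })
          (Sum.[ (λ (conn , ¬conn) → inj₁ (conn , ¬conn ∘ remove))
               , (λ (conn , ¬conn) → inj₂ (added conn , ¬conn)) ] ∘ to tight)
          where
          -- As i lies in Y, this is Y without i: the only I avoiding i with I ∪ {i} = Y.
          Y⁻ : Subset n
          Y⁻ = Y △ ⁅ i ⁆

          Y⁻-off : lookup Y⁻ i ≡ false
          Y⁻-off = trans (lookup-△⁅⁆-≡ Y i) (cong (_xor true) eq)

          Added : Set
          Added = ∃[ I ] frameSystem F ρ s I × ¬ (i Sub.∈ I) × Y ≡ I Sub.∪ ⁅ i ⁆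

          added : frameSystem F ρ s Y⁻ → Added
          added conn = Y⁻ , conn
            , (λ i∈Y⁻ → contradiction (trans (sym Y⁻-off) (∈⇒lookup i∈Y⁻)) λ ())
            , ∪-△-cancel eq

          remove : Added → frameSystem F ρ s Y⁻
          remove (I , conn , i∉I , refl) =
            subst (frameSystem F ρ s) (△-∪-cancel {X = I} (∉⇒lookup i∉I)) conn

          tight : frameSystem F ρ s⁺ Y ⇔ ((frameSystem F ρ s Y × ¬ frameSystem F ρ s Y⁻)
                                          ⊎ (frameSystem F ρ s Y⁻ × ¬ frameSystem F ρ s Y))
          tight = connecting-third F u (s u) {chosen s Y⁻} {chosen s Y} {chosen s⁺ Y}
            (λ v v≢u → cong (choose (s v)) (lookup-△⁅⁆-≢ Y (off-u v≢u)))
            (λ v v≢u → cong₂ choose (sym (modify-≢ i _ s v (off-u v≢u))) (lookup-△⁅⁆-≢ Y (off-u v≢u)))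
            (cong (choose (s u)) (trans (cong (lookup Y⁻) ρu≡i) Y⁻-off))
            (cong (choose (s u)) (trans (cong (lookup Y) ρu≡i) eq))
            (trans (cong₂ choose (modify-≡ i _ s u ρu≡i)
              (trans (cong (lookup Y) ρu≡i) eq)) (second-+ (s u)))

      generator-frameSystem : ∀ a i s → applyGenerator a i (frameSystem F ρ s)
                                      ≐ frameSystem F ρ (modify i (actGenerator a) s)
      generator-frameSystem ∗ = ∗-frameSystem
      generator-frameSystem + = +-frameSystem

      word-frameSystem : ∀ w i s → applyWord w i (frameSystem F ρ s)
                                 ≐ frameSystem F ρ (modify i (actWord w) s)
      word-frameSystem []      i s = frameSystem-cong ρ ρ (λ _ → refl) same
        where
        same : s ≗ modify i (actWord []) s
        same v with ρ→ v ≟ i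
        ... | yes _ = refl
        ... | no _  = refl
      word-frameSystem (a ∷ w) i s =
        ≐-trans (applyGenerator-cong a i (word-frameSystem w i s))
          (≐-trans (generator-frameSystem a i (modify i (actWord w) s))
            (frameSystem-cong ρ ρ (λ _ → refl) same))
        where
        same : modify i (actGenerator a) (modify i (actWord w) s) ≗ modify i (actWord (a ∷ w)) s
        same v with ρ→ v ≟ i in eq
        ... | yes _ rewrite eq = refl
        ... | no _  rewrite eq = refl

      module _ (ĝ : Fin n → Word) (s : Frames F) where

        framesAfter : List (Fin n) → Frames F
        framesAfter = foldr (λ i → modify i (actWord (ĝ i))) s

        words-frameSystem : ∀ is → foldr (λ i → applyWord (ĝ i) i) (frameSystem F ρ s) is
                                 ≐ frameSystem F ρ (framesAfter is)
        words-frameSystem []       = ≐-refl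
        words-frameSystem (i ∷ is) =
          ≐-trans (applyWord-cong (ĝ i) i (words-frameSystem is)) (word-frameSystem (ĝ i) i _)

        framesAfter-∉ : ∀ is {v} → ρ→ v ∉ˡ is → framesAfter is v ≡ s v
        framesAfter-∉ []       _     = refl
        framesAfter-∉ (i ∷ is) ρv∉is =
          trans (modify-≢ i _ _ _ (ρv∉is ∘ here)) (framesAfter-∉ is (ρv∉is ∘ there))

        -- The frame at v changes only when the index of v is treated, and in a list without
        -- repetitions this happens once.
        framesAfter-∈ : ∀ {is} → Unique is → ∀ {v} → ρ→ v ∈ˡ is →
                        framesAfter is v ≡ actWord (ĝ (ρ→ v)) (s v)
        framesAfter-∈ {i ∷ is} (i∉is ∷ _)  (here refl) =
          trans (modify-≡ i _ _ _ refl)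
            (cong (actWord (ĝ i)) (framesAfter-∉ is (λ i∈is → All.lookup i∉is i∈is refl)))
        framesAfter-∈ {i ∷ is} (i∉is ∷ is!) (there ρv∈is) =
          trans (modify-≢ i _ _ _ (λ { refl → All.lookup i∉is ρv∈is refl })) (framesAfter-∈ is! ρv∈is)

        ·-frameSystem : (ĝ · frameSystem F ρ s)
                      ≐ frameSystem F ρ (λ v → actWord (ĝ (ρ→ v)) (s v))
        ·-frameSystem = ≐-trans (words-frameSystem (allFin n))
          (frameSystem-cong ρ ρ (λ _ → refl) λ v → framesAfter-∈ (Uniqueₚ.allFin⁺ n) (∈-allFin _))

-- Transversal triples and projections as frames and numberings

module _ (F : FourRegularGraph) where
  open FourRegularGraph F
  open TransversalTriple
  open Projection using (σ; surjective)

  -- A basis inside T₁ ∪ T₂ makes one choice per vertex, the first or the second transition. As Y is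
  -- the image of its part in T₂, membership in Y records exactly where the second is chosen.
  setSystem-frameSystem : ∃ (Linked graph HasClasses_) → ∀ {n}
    (τ : TransversalTriple (transitions F)) (σ′ : Projection (transitions F) n)
    (ρ : Vertex ↔ Fin n) (s : Frames F) →
    Selects F (T₁ τ) (first ∘ s) → Selects F (T₂ τ) (second ∘ s) →
    (∀ v q → σ σ′ (v , q) ≡ Inverse.to ρ v) →
    setSystem (Z F) τ σ′ ≐ frameSystem F ρ s
  setSystem-frameSystem k-classes τ σ′ ρ s sel₁ sel₂ σ≡ρ = feasible⇒connecting , connecting⇒feasible
    where
    open Inverse ρ using () renaming (to to ρ→; from to ρ←)

    feasible⇒connecting : ∀ {Y} → setSystem (Z F) τ σ′ Y → frameSystem F ρ s Y
    feasible⇒connecting {Y} (X , X-basis , X⊆T₁∪T₂ , img) with basis⇒connecting F X-basis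
    ... | t , sel , conn = connecting-cong F t-chosen conn
      where
      t-chosen : ∀ v → t v ≡ choose (s v) (lookup Y (ρ→ v))
      t-chosen v with lookup Y (ρ→ v) in eq
      ... | true with to (img (ρ→ v)) (lookup⇒∈ eq)
      ...   | (w , q) , (q∈X , q∈T₂) , σ≡
        with refl ← Injection.injective (↔⇒↣ ρ) (trans (sym (σ≡ρ w q)) σ≡) =
        trans (sym (to (sel v q) q∈X)) (to (sel₂ v q) q∈T₂)
      t-chosen v | false with X⊆T₁∪T₂ (v , t v) (from (sel v (t v)) refl)
      ...   | inj₁ t∈T₁ = to (sel₁ v (t v)) t∈T₁
      ...   | inj₂ t∈T₂ = contradiction
        (trans (sym eq) (∈⇒lookup (from (img (ρ→ v))
          ((v , t v) , (from (sel v (t v)) refl , t∈T₂) , σ≡ρ v _))))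
        λ ()

    connecting⇒feasible : ∀ {Y} → frameSystem F ρ s Y → setSystem (Z F) τ σ′ Y
    connecting⇒feasible {Y} conn =
        selection F t , connecting⇒basis F k-classes (selection-selects F t) conn , X⊆T₁∪T₂ , img
      where
      t : Vertex → Pairing
      t v = choose (s v) (lookup Y (ρ→ v))

      X⊆T₁∪T₂ : ∀ u → u ∈ selection F t → u ∈ T₁ τ ⊎ u ∈ T₂ τ
      X⊆T₁∪T₂ (v , q) q∈X with to (selection-selects F t v q) q∈X
      ... | q≡ with lookup Y (ρ→ v)
      ...   | true  = inj₂ (from (sel₂ v q) q≡)
      ...   | false = inj₁ (from (sel₁ v q) q≡)

      img : IsImage (σ σ′) (λ u → u ∈ selection F t × u ∈ T₂ τ) Y
      img i = mk⇔
        (λ i∈Y → let v = ρ← i ; ρv≡i = Inverse.strictlyInverseˡ ρ i in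
          (v , second (s v))
          , (from (selection-selects F t v _)
               (cong (choose (s v)) (sym (trans (cong (lookup Y) ρv≡i) (∈⇒lookup i∈Y))))
            , from (sel₂ v _) refl)
          , trans (σ≡ρ v _) ρv≡i)
        (λ { ((v , q) , (q∈X , q∈T₂) , σ≡i) → lookup⇒∈ (subst (λ i → lookup Y i ≡ true)
               (trans (sym (σ≡ρ v q)) σ≡i)
               (on v (trans (sym (to (selection-selects F t v q) q∈X)) (to (sel₂ v q) q∈T₂)))) })
        where
        on : ∀ v → t v ≡ second (s v) → lookup Y (ρ→ v) ≡ true
        on v with lookup Y (ρ→ v)
        ... | true  = λ _ → refl
        ... | false = λ eq → contradiction eq (first≢second (s v))

  tripleFrames : (τ : TransversalTriple (transitions F)) →
                 Σ (Frames F) λ s → Selects F (T₁ τ) (first ∘ s) × Selects F (T₂ τ) (second ∘ s)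
  tripleFrames τ with transversal⇒selects F (transversal₁ τ) | transversal⇒selects F (transversal₂ τ)
  ... | t₁ , sel₁ | t₂ , sel₂ = proj₁ ∘ frames
      , (λ v q → subst (λ p → (v , q) ∈ T₁ τ ⇔ q ≡ p) (sym (proj₁ (proj₂ (frames v)))) (sel₁ v q))
      , (λ v q → subst (λ p → (v , q) ∈ T₂ τ ⇔ q ≡ p) (sym (proj₂ (proj₂ (frames v)))) (sel₂ v q))
    where
    frames : ∀ v → ∃[ f ] first f ≡ t₁ v × second f ≡ t₂ v
    frames v = frame-of λ t₁≡t₂ →
      disjoint₁₂ τ (v , t₁ v) (from (sel₁ v _) refl , from (sel₂ v _) t₁≡t₂)

  frameTriple : Frames F → TransversalTriple (transitions F)
  frameTriple s = record
    { T₁ = selection F (first ∘ s)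
    ; T₂ = selection F (second ∘ s)
    ; T₃ = selection F (third ∘ s)
    ; transversal₁ = selects⇒transversal F (sel (first ∘ s))
    ; transversal₂ = selects⇒transversal F (sel (second ∘ s))
    ; transversal₃ = selects⇒transversal F (sel (third ∘ s))
    ; disjoint₁₂ = λ (v , q) (p₁ , p₂) →
        first≢second (s v) (trans (sym (to (sel (first ∘ s) v q) p₁)) (to (sel (second ∘ s) v q) p₂))
    ; disjoint₁₃ = λ (v , q) (p₁ , p₃) →
        first≢third (s v) (trans (sym (to (sel (first ∘ s) v q) p₁)) (to (sel (third ∘ s) v q) p₃))
    ; disjoint₂₃ = λ (v , q) (p₂ , p₃) →
        second≢third (s v) (trans (sym (to (sel (second ∘ s) v q) p₂)) (to (sel (third ∘ s) v q) p₃))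
    ; covering = λ (v , q) →
        Sum.map (from (sel (first ∘ s) v q))
          (Sum.map (from (sel (second ∘ s) v q)) (from (sel (third ∘ s) v q)))
          (frame-cover (s v) q)
    }
    where sel = selection-selects F

  projectionNumbering : ∀ {n} (σ′ : Projection (transitions F) n) →
                        Σ (Vertex ↔ Fin n) λ ρ → ∀ v q → σ σ′ (v , q) ≡ Inverse.to ρ v
  projectionNumbering σ′ =
    mk↔ₛ′ ρ (proj₁ ∘ hit)
      (λ i → hits i refl)
      (λ v → to (classes σ′ _ _) (hits (ρ v) refl))
    , σ≡ρ
    where
    open Projection using (classes)
    -- Any transition at v gives the same value, since a projection is constant on classes.
    ρ = λ v → σ σ′ (v , 01∣23)
    hit = proj₁ ∘ surjective σ′
    σ≡ρ : ∀ v q → σ σ′ (v , q) ≡ ρ v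
    σ≡ρ v q = from (classes σ′ _ _) refl
    hits : ∀ i {v} → v ≡ proj₁ (hit i) → ρ v ≡ i
    hits i refl = trans (sym (σ≡ρ _ _)) (proj₂ (surjective σ′ i) refl)

  numberingProjection : ∀ {n} → Vertex ↔ Fin n → Projection (transitions F) n
  numberingProjection ρ = record
    { σ          = Inverse.to ρ ∘ proj₁
    ; surjective = λ i → (Inverse.from ρ i , 01∣23) , λ { refl → Inverse.strictlyInverseˡ ρ i }
    ; classes    = λ _ _ → mk⇔ (Injection.injective (↔⇒↣ ρ)) (cong (Inverse.to ρ))
    }

-- Ribbon graphs, their boundary components and their medial graphs

module _ (G : RibbonGraph) where
  open RibbonGraph G

  private
    M : FourRegularGraph
    M = medial G

    module ~ᴬ {F} = IsEquivalence (EqC.isEquivalence (Adjacent G F))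

  at-next : ∀ s → at s ≡ at (Inverse.to next s)
  at-next s = from (cyclic _ _) (1 , refl)

  at-arc : ∀ c → at (proj₁ c) ≡ at (proj₁ (arc c))
  at-arc (s , 0F) = sym (trans (at-next _) (cong at (Inverse.strictlyInverseˡ next s)))
  at-arc (s , 1F) = at-next s

  edge-ends : ∀ e j → EqClosure (Adjacent G (allEdges G)) (at (e , 0F)) (at (e , j))
  edge-ends e 0F = ~ᴬ.refl
  edge-ends e 1F = EqC.return (edge refl)

  module _ {_~_ : Rel (BoundaryPoint G) 0ℓ} (~-equiv : IsEquivalence _~_)
           (corners : ∀ e {j i j′ i′} → inj₁ ((e , j) , i) ~ inj₁ ((e , j′) , i′))
           (arcs : ∀ c → inj₁ c ~ inj₁ (arc c)) where
    private module ~ = IsEquivalence ~-equiv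

    -- By `cyclic`, the segments at a vertex form one orbit of `next`, so alternating between the
    -- corners of a segment and the arc to the next one goes round the vertex.
    same-vertex-related : ∀ {p q} → vertexOf G p ≡ vertexOf G q → p ~ q
    same-vertex-related {inj₁ (s , _)} {inj₁ (t , _)} eq = around (to (cyclic s t) eq)
      where
      around : ∀ {s t i j} → ∃[ k ] iterate (Inverse.to next) s k ≡ t → inj₁ (s , i) ~ inj₁ (t , j)
      around (zero  , refl) = corners _
      around {s} (suc k , eq) = ~.trans (corners _) (~.trans (arcs (s , 1F)) (around (k , eq)))
    same-vertex-related {inj₁ (s , _)} {inj₂ (_ , [ isolated ])} eq   = ⊥-elim-irr (isolated s eq)
    same-vertex-related {inj₂ (_ , [ isolated ])} {inj₁ (s , _)} eq   = ⊥-elim-irr (isolated s (sym eq))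
    same-vertex-related {inj₂ (v , _)} {inj₂ (.v , _)} refl = ~.refl

    -- Applied to two relations: connectivity in the medial graph, and lying on the same boundary
    -- component.
    adjacent-related : ∀ {v w} → EqClosure (Adjacent G (allEdges G)) v w →
                       ∀ {p q} → vertexOf G p ≡ v → vertexOf G q ≡ w → p ~ q
    adjacent-related ε                         p≡ q≡ = same-vertex-related (trans p≡ (sym q≡))
    adjacent-related (fwd (edge {e} _) ◅ path) p≡ q≡ =
      ~.trans (same-vertex-related {q = inj₁ ((e , 0F) , 0F)} p≡)
        (~.trans (corners e) (adjacent-related path {inj₁ ((e , 1F) , 0F)} refl q≡))
    adjacent-related (bwd (edge {e} _) ◅ path) p≡ q≡ =
      ~.trans (same-vertex-related {q = inj₁ ((e , 1F) , 0F)} p≡)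
        (~.trans (corners e) (adjacent-related path {inj₁ ((e , 0F) , 0F)} refl q≡))

  pointAt : ∀ v → ∃[ p ] vertexOf G p ≡ v
  pointAt v with any? (λ e → any? (λ j → at (e , j) ≟ v))
  ... | yes (e , j , eq) = inj₁ ((e , j) , 0F) , eq
  ... | no none          = inj₂ (v , [ (λ (e , j) eq → none (e , j , eq)) ]) , refl

  -- The components of G arise from equality of vertices by joining the two ends of one edge after
  -- another.
  adjacent-classes : ∃ (Adjacent G (allEdges G) HasClasses_)
  adjacent-classes = Product.map₂ (numbering-resp-⇔
      (joinAll-least (EqC.isEquivalence _) ends joined)
      (EqC.fold (joinAll-isEquivalence ends)
        λ { (edge {e} _) → joinAll-member ends (∈-map⁺ endsOf (∈-allFin e)) }))
    (joinAll-numbering ends)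
    where
    endsOf : Edge → Vertex × Vertex
    endsOf e = at (e , 0F) , at (e , 1F)
    ends = map endsOf (allFin #E)
    joined : ∀ {v w} → (v , w) ∈ˡ ends → EqClosure (Adjacent G (allEdges G)) v w
    joined vw∈ with ∈-map⁻ endsOf vw∈
    ... | e , _ , refl = EqC.return (edge refl)

  -- The medial graph has the same components as G: a medial vertex lies in the component of either
  -- end of its edge, and a free loop corresponds to its isolated vertex. Every vertex of G is
  -- reached because it carries a corner or is isolated.
  medial-classes : ∃ (Linked (FourRegularGraph.graph M) HasClasses_)
  medial-classes with adjacent-classes
  ... | k , f , f-surj , f-classes = k , g , g-surj , λ x y → mk⇔
      (EqC.gfold isEquivalence g (λ { (link h) → linked h }))
      (λ eq → subst₂ (EqClosure _) (π∘rep x) (π∘rep y)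
        (adjacent-related (On.isEquivalence π (EqC.isEquivalence _)) (λ _ → ≈.refl) arcs
          (from (f-classes _ _) eq) {rep x} {rep y} refl refl))
    where
    module ≈ = IsEquivalence (EqC.isEquivalence (Linked (FourRegularGraph.graph M)))

    π : BoundaryPoint G → Edge ⊎ IsolatedVertex
    π = Sum.map₁ (proj₁ ∘ proj₁)

    rep : Edge ⊎ IsolatedVertex → BoundaryPoint G
    rep = Sum.map₁ λ e → (e , 0F) , 0F

    π∘rep : ∀ x → π (rep x) ≡ x
    π∘rep (inj₁ _) = refl
    π∘rep (inj₂ _) = refl

    g : Edge ⊎ IsolatedVertex → Fin k
    g = f ∘ vertexOf G ∘ rep

    g∘π : ∀ p → g (π p) ≡ f (vertexOf G p)
    g∘π (inj₁ ((e , j) , _)) = to (f-classes _ _) (edge-ends e j)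
    g∘π (inj₂ _)             = refl

    g-surj : ∀ c → ∃ λ x → ∀ {y} → y ≡ x → g y ≡ c
    g-surj c with f-surj c
    ... | v , fv≡c with pointAt v
    ... | p , refl = π p , λ { refl → trans (g∘π p) (fv≡c refl) }

    linked : ∀ h → g (inj₁ (proj₁ h)) ≡ g (inj₁ (proj₁ (FourRegularGraph.mate M h)))
    linked h = trans (g∘π (inj₁ c)) (trans (cong f (at-arc c)) (sym (g∘π (inj₁ (arc c)))))
      where c = toCorner G h

    arcs : ∀ c → EqClosure (Linked (FourRegularGraph.graph M)) (π (inj₁ c)) (π (inj₁ (arc c)))
    arcs c = subst (λ d → EqClosure _ (π (inj₁ c)) (π (inj₁ (arc d)))) (to∘from G c)
      (EqC.return (link (fromCorner G c)))

  -- 01∣23 follows the segments of an edge, the second pairing of the frame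
  -- its sides.
  ribbonFrames : Frames M
  ribbonFrames e = 01∣23 , twisted e

  module _ (F : FSet Edge) where
    private
      t : Edge → Pairing
      t e = choose (ribbonFrames e) (F e)

      B : Rel (BoundaryPoint G) 0ℓ
      B = EqClosure (BoundaryArc G F)

      S : Rel (Edge × Fin 4) 0ℓ
      S = EqClosure (Step M t)

      module ~ᴮ = IsEquivalence (EqC.isEquivalence (BoundaryArc G F))
      module ~ˢ = IsEquivalence (EqC.isEquivalence (Step M t))

    -- Half-edge 2j + i of e stands for the corner ((e , j) , i). The segments of e give 01∣23; its
    -- sides join i to i if e is twisted, giving 02∣13, and i to its opposite otherwise, giving
    -- 03∣12.
    step⇒boundary : ∀ {g h} → S g h → B (inj₁ (toCorner G g)) (inj₁ (toCorner G h))
    step⇒boundary = EqC.gfold (EqC.isEquivalence _) (inj₁ ∘ toCorner G) λ where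
        (cross h)  → subst (λ c → B (inj₁ (toCorner G h)) (inj₁ c)) (sym (to∘from G _))
                       (EqC.return (vertexArc (toCorner G h)))
        (turn e i) → turned e i
      where
      sideOf : ∀ {e} → F e ≡ true → ∀ i →
               B (inj₁ ((e , 0F) , i)) (inj₁ ((e , 1F) , (if twisted e then i else opposite i)))
      sideOf e∈F i = EqC.return (side e∈F i)

      segmentOf : ∀ {e} → F e ≡ false → ∀ j → B (inj₁ ((e , j) , 0F)) (inj₁ ((e , j) , 1F))
      segmentOf e∉F j = EqC.return (segment (λ e∈F → contradiction (trans (sym e∉F) e∈F) λ ()) j)

      turned : ∀ e i → B (inj₁ (toCorner G (e , i))) (inj₁ (toCorner G (e , partner (t e) i)))
      turned e i with F e in F≡
      turned e 0F | false = segmentOf F≡ 0F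
      turned e 1F | false = ~ᴮ.sym (segmentOf F≡ 0F)
      turned e 2F | false = segmentOf F≡ 1F
      turned e 3F | false = ~ᴮ.sym (segmentOf F≡ 1F)
      turned e i  | true with twisted e | sideOf F≡
      turned e 0F | true | true  | sides = sides 0F
      turned e 1F | true | true  | sides = sides 1F
      turned e 2F | true | true  | sides = ~ᴮ.sym (sides 0F)
      turned e 3F | true | true  | sides = ~ᴮ.sym (sides 1F)
      turned e 0F | true | false | sides = sides 0F
      turned e 1F | true | false | sides = sides 1F
      turned e 2F | true | false | sides = ~ᴮ.sym (sides 1F)
      turned e 3F | true | false | sides = ~ᴮ.sym (sides 0F)

    boundary⇒step : ∀ {c d} → B (inj₁ c) (inj₁ d) → S (fromCorner G c) (fromCorner G d)
    boundary⇒step = drop-inj₁ ∘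
        EqC.fold
          (⊎-isEquivalence (On.isEquivalence (fromCorner G) (EqC.isEquivalence _)) isEquivalence) λ where
          (vertexArc c)   → Pointwise.inj₁
            (subst (λ d → S (fromCorner G c) (fromCorner G (arc d))) (to∘from G c)
              (EqC.return (cross (fromCorner G c))))
          (side {e} e∈F i) → Pointwise.inj₁ (sided e e∈F i)
          (segment {e} e∉F j) → Pointwise.inj₁ (segmented e e∉F j)
      where
      turned : ∀ e i → S (e , i) (e , partner (t e) i)
      turned e i = EqC.return (turn e i)

      sided : ∀ e → F e ≡ true → ∀ i → S (fromCorner G ((e , 0F) , i))
                (fromCorner G ((e , 1F) , (if twisted e then i else opposite i)))
      sided e F≡ i with turned e 0F | turned e 1F
      ... | p₀ | p₁ rewrite F≡ with twisted e
      sided e F≡ 0F | p₀ | p₁ | true  = p₀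
      sided e F≡ 1F | p₀ | p₁ | true  = p₁
      sided e F≡ 0F | p₀ | p₁ | false = p₀
      sided e F≡ 1F | p₀ | p₁ | false = p₁

      segmented : ∀ e → ¬ (F e ≡ true) → ∀ j →
                  S (fromCorner G ((e , j) , 0F)) (fromCorner G ((e , j) , 1F))
      segmented e F≢ j with turned e 0F | turned e 2F
      ... | p₀ | p₂ with F e
      segmented e F≢ j  | p₀ | p₂ | true  = contradiction refl F≢
      segmented e F≢ 0F | p₀ | p₂ | false = p₀
      segmented e F≢ 1F | p₀ | p₂ | false = p₂

    boundary⇒adjacent : ∀ {p q} → B p q → EqClosure (Adjacent G F) (vertexOf G p) (vertexOf G q)
    boundary⇒adjacent = EqC.gfold (EqC.isEquivalence _) (vertexOf G) λ where
      (vertexArc c) → ~ᴬ.reflexive (at-arc c)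
      (side e∈F i)  → EqC.return (edge e∈F)
      (segment _ _) → ~ᴬ.refl

    -- All corners of an edge lie on one boundary component, which stays within one component of (V
    -- , F). So the ends of every edge of G are connected in F, and arcs and corners lead between
    -- any two boundary points of a component.
    connecting⇒quasiTree : Connecting M t → IsSpanningQuasiTree G F
    connecting⇒quasiTree conn = sameNumber , λ v →
        (λ w → (all⇒F EqC.⋆)) ,
        (let p , p≡v = pointAt v in p , ~ᴬ.reflexive (sym p≡v)) ,
        (λ p q v~p v~q → adjacent-related (EqC.isEquivalence _) corners (EqC.return ∘ vertexArc)
           (EqC.map (λ { (edge _) → edge refl }) (~ᴬ.trans (~ᴬ.sym v~p) v~q)) refl refl)
      where
      corners : ∀ e {j i j′ i′} → B (inj₁ ((e , j) , i)) (inj₁ ((e , j′) , i′))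
      corners e {j} {i} {j′} {i′} =
        subst₂ (λ c d → B (inj₁ c) (inj₁ d)) (to∘from G _) (to∘from G _)
          (step⇒boundary (conn e (proj₂ (fromCorner G ((e , j) , i)))
                                  (proj₂ (fromCorner G ((e , j′) , i′)))))

      all⇒F : Adjacent G (allEdges G) ⇒ EqClosure (Adjacent G F)
      all⇒F (edge {e} _) = boundary⇒adjacent (corners e {0F} {0F} {1F} {0F})

      sameNumber : SameNumberOfClasses (Adjacent G F) (Adjacent G (allEdges G))
      sameNumber with adjacent-classes
      ... | k , numbering =
        k , numbering-resp-⇔ (all⇒F EqC.⋆) (EqC.map (λ { (edge _) → edge refl })) numbering
          , numbering

    -- The four corners of e lie in the component of one of its ends, which has a single boundary
    -- component.
    quasiTree⇒connecting : IsSpanningQuasiTree G F → Connecting M t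
    quasiTree⇒connecting (_ , trees) e i j with trees (at (e , 0F))
    ... | connected , _ , one-boundary =
      subst₂ S (from∘to G (e , i)) (from∘to G (e , j))
        (boundary⇒step (one-boundary (inj₁ (toCorner G (e , i))) (inj₁ (toCorner G (e , j)))
          (connected _ (edge-ends e _)) (connected _ (edge-ends e _))))

  deltaMatroid-frameSystem : ∀ {n} (o : Edge ⤖ Fin n) →
    deltaMatroid G o ≐ frameSystem M (⤖⇒↔ o) ribbonFrames
  deltaMatroid-frameSystem o = quasiTree⇒connecting _ , connecting⇒quasiTree _

-- The two inclusions

theorem6p3 : (n : ℕ) (G : RibbonGraph) → RibbonGraph.#E G ≡ n →
    (o : RibbonGraph.Edge G ⤖ Fin n) →
    Orb (deltaMatroid G o) ≐ SetSystemsOf n (medial G)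
theorem6p3 n G _ o = orbit⊆ , orbit⊇
  where
  M = medial G

  ρ : RibbonGraph.Edge G ↔ Fin n
  ρ = ⤖⇒↔ o

  actedFrames : (Fin n → Word) → Permutation′ n → Frames M
  actedFrames ĝ π v = actWord (ĝ (Inverse.to (ρ ∘ₚ π) v)) (ribbonFrames G v)

  act-deltaMatroid : ∀ ĝ π →
    (ĝ · relabel π (deltaMatroid G o)) ≐ frameSystem M (ρ ∘ₚ π) (actedFrames ĝ π)
  act-deltaMatroid ĝ π = ≐-trans
    (·-cong ĝ (≐-trans (relabel-cong π (deltaMatroid-frameSystem G o))
                       (relabel-frameSystem M ρ π (ribbonFrames G))))
    (·-frameSystem M (ρ ∘ₚ π) ĝ (ribbonFrames G))

  orbit⊆ : ∀ {D} → Orb (deltaMatroid G o) D → SetSystemsOf n M D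
  orbit⊆ (ĝ , π , D≐) = frameTriple M s , numberingProjection M (ρ ∘ₚ π) ,
    ≐-trans D≐ (≐-trans (act-deltaMatroid ĝ π)
        (≐-sym (setSystem-frameSystem M (medial-classes G)
          (frameTriple M s) (numberingProjection M (ρ ∘ₚ π)) (ρ ∘ₚ π) s
          (selection-selects M _) (selection-selects M _) (λ _ _ → refl))))
    where
    s : Frames M
    s = actedFrames ĝ π

  orbit⊇ : ∀ {D} → SetSystemsOf n M D → Orb (deltaMatroid G o) D
  orbit⊇ {D} (τ , σ , D≐) with tripleFrames M τ | projectionNumbering M σ
  ... | s , sel₁ , sel₂ | ρ′ , σ≡ρ′ = ĝ , π ,
    ≐-trans D≐ (≐-trans (setSystem-frameSystem M (medial-classes G) τ σ ρ′ s sel₁ sel₂ σ≡ρ′)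
      (≐-sym (≐-trans (act-deltaMatroid ĝ π) (frameSystem-cong M (ρ ∘ₚ π) ρ′ ρπ≗ρ′ reached))))
    where
    -- Chosen so that ρ followed by π is ρ′, the numbering given by σ.
    π : Permutation′ n
    π = flip ρ ∘ₚ ρ′

    word : ∀ v → ∃[ w ] actWord w (ribbonFrames G v) ≡ s v
    word v = actWord-transitive (ribbonFrames G v) (s v)

    -- After relabelling, i is the number of the vertex `Inverse.from ρ′ i`; its word carries the
    -- ribbon frame there to the frame given by τ.
    ĝ : Fin n → Word
    ĝ i = proj₁ (word (Inverse.from ρ′ i))

    ρπ≗ρ′ : ∀ v → Inverse.to (ρ ∘ₚ π) v ≡ Inverse.to ρ′ v
    ρπ≗ρ′ v = cong (Inverse.to ρ′) (Inverse.strictlyInverseʳ ρ v)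

    reached : actedFrames ĝ π ≗ s
    reached v = trans
      (cong (λ u → actWord (proj₁ (word u)) (ribbonFrames G v))
        (trans (cong (Inverse.from ρ′) (ρπ≗ρ′ v)) (Inverse.strictlyInverseʳ ρ′ v)))
      (proj₂ (word v))
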